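{- For every integer $l\ge 1$, the problem Sliding-$l^{\text{th}}$-Smallest can be solved by a multi-pass streaming algorithm that uses $l+1$ input passes, $l$ output passes, and $O\big(l^{3/2}N^{1/2}(\log N+\log R)\big)$ bits of space, where $N$ is the length of the input and $R$ is the upper bound on its values (the bound holds for every window size $K$, with an absolute implied constant).
   Context: Problem. The input is an array $A_0,\dots,A_{N-1}$ of integers in $[0,R]$ together with a window size $K\le N$ (with $l\le K$). Sliding-$l^{\text{th}}$-Smallest asks for, for every $i\in\{0,\dots,N-K\}$, the value of the $l$-th smallest element (counted with multiplicity) among $A_i,\dots,A_{i+K-1}$. Multi-pass streaming model. The algorithm knows $N,K,R$ in advance. The input can be accessed only through sequential left-to-right scans; each scan is one input pass. The output is written to a write-only output stream with $N-K+1$ positions, position $i$ being for the answer of the window $[i,i+K-1]$; every position is written exactly once, and writing is done in linear left-to-right scans of the output stream. The number of output passes is the number of such scans, i.e. the sequence of window indices $i$ in the order in which their answers are written is a concatenation of that many strictly increasing sequences. Output need not be synchronized with the input position: at any time the algorithm may write any number of answers. Space is the maximum number of bits of working memory held at any time (input and output streams are not counted). -}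

module Defs where

open import Data.Bool.Base using (Bool)
open import Data.Nat.Base using (ℕ; suc; pred; _+_; _*_; _∸_; _^_; _≤_)
open import Data.Nat.Logarithm using (⌈log₂_⌉)
open import Data.Fin.Base using (Fin; toℕ; _<_)
open import Data.Fin.Properties using (≤-decTotalOrder)
open import Data.List.Base using (List; []; _∷_; map; concat; take; drop; head; allFin; length)
open import Data.List.Relation.Unary.All using (All)
open import Data.List.Relation.Unary.Linked using (Linked)
open import Data.List.Relation.Binary.Permutation.Propositional using (_↭_)
import Data.List.Sort as Sort
open import Data.Maybe.Base using (just)
open import Data.Product.Base using (_×_; _,_; proj₁; ∃-syntax)
open import Data.Vec.Base as Vec using (Vec)
open import Relation.Binary.PropositionalEquality.Core using (_≡_)

-- The integers in [0,R].
Value : ℕ → Set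
Value R = Fin (suc R)

-- The window positions 0,…,N-K (used only for K ≤ N).
Position : ℕ → ℕ → Set
Position N K = Fin (suc (N ∸ K))

Memory : ℕ → Set
Memory s = Vec Bool s

-- What a machine with s bits of memory does next, with the memory contents
-- afterwards.  Neither the head positions nor the number of the current scan
-- is available to the machine, except through what it stores in its memory.
data Action (N K R s : ℕ) : Set where
  read   : (Value R → Memory s) → Action N K R s
  write  : Position N K → Value R → Memory s → Action N K R s
  rewind : Memory s → Action N K R s
  halt   : Action N K R s

-- The model is non-uniform: N, K, R and s are fixed.
-- Each read, write or rewind is a separate step, and the s bits are all that is
-- kept between steps.
record Algorithm (N K R s : ℕ) : Set where
  field
    initial : Memory s
    control : Memory s → Action N K R s

module _ {N K R s : ℕ} (A : Algorithm N K R s) (input : Vec (Value R) N) where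
  open Algorithm A

  -- Run m xs p ws: from memory contents m, with xs the part of the input not yet
  -- read in the current scan, the machine halts after starting p further input
  -- scans and writing exactly ws, in this order.  A machine that reads past the
  -- end of the input, or never halts, has no run.
  data Run (m : Memory s) : List (Value R) → ℕ → List (Position N K × Value R) → Set where
    halts   : ∀ {xs} → control m ≡ halt → Run m xs 0 []
    reads   : ∀ {f x xs p ws} → control m ≡ read f →
              Run (f x) xs p ws → Run m (x ∷ xs) p ws
    writes  : ∀ {i v m′ xs p ws} → control m ≡ write i v m′ →
              Run m′ xs p ws → Run m xs p ((i , v) ∷ ws)
    rewinds : ∀ {m′ xs p ws} → control m ≡ rewind m′ →
              Run m′ (Vec.toList input) p ws → Run m xs (suc p) ws

  -- The first input pass is under way at the start, hence suc p.
  Produces : (passes : ℕ) → List (Position N K × Value R) → Set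
  Produces passes ws =
    ∃[ p ] (suc p ≡ passes × Run initial (Vec.toList input) p ws)

window : ∀ {N R} (K : ℕ) → Vec (Value R) N → Position N K → List (Value R)
window K input i = take K (drop (toℕ i) (Vec.toList input))

-- l counts from 1; the sorted list keeps repeated elements.
IsSmallest : ∀ {R} → (l : ℕ) → List (Value R) → Value R → Set
IsSmallest {R} l xs v = head (drop (pred l) (sort xs)) ≡ just v
  where open Sort (≤-decTotalOrder (suc R)) using (sort)

WrittenOnce : ∀ {N K} → List (Position N K) → Set
WrittenOnce {N} {K} is = is ↭ allFin (suc (N ∸ K))

-- A scan may write nothing, so this also covers fewer than q scans.
OutputPasses : ∀ {N K} → (q : ℕ) → List (Position N K) → Set
OutputPasses {N} {K} q is = ∃[ scans ]
  ( length scans ≡ q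
  × All (Linked _<_) scans
  × concat scans ≡ is )

SolvesSliding : ∀ {N K R s} → (l inputPasses outputPasses : ℕ) → Algorithm N K R s → Set
SolvesSliding {N} {K} {R} l inputPasses outputPasses A =
  (input : Vec (Value R) N) → ∃[ p ] ∃[ ws ]
    ( p ≤ inputPasses
    × Produces A input p ws
    × WrittenOnce {N} {K} (map proj₁ ws)
    × OutputPasses {N} {K} outputPasses (map proj₁ ws)
    × All (λ (i , v) → IsSmallest l (window K input i) v) ws )

-- Adding 1 inside the logarithms avoids log 0 and keeps the sum positive when
-- N = 1; for N, R ≥ 2 each logarithm changes by at most a constant factor.
logTerm : ℕ → ℕ → ℕ
logTerm N R = ⌈log₂ suc N ⌉ + ⌈log₂ suc R ⌉

-- s ≤ C · l^(3/2) · N^(1/2) · (log N + log R), with both sides squared.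
SpaceBound : (C l N R s : ℕ) → Set
SpaceBound C l N R s = s ^ 2 ≤ (C * logTerm N R) ^ 2 * (l ^ 3 * N)

{-# OPTIONS --safe #-}
module Submission where

-- Split window i at time t into the elements before position t and the rest, and let Φ_t(i) be 2c
-- if its l-th smallest element is the c-th smallest of the first part, and 2c+1 if it is the
-- (l-c)-th smallest of the second part.  Φ_t(i) lies in [1,2l], is nonincreasing in i and
-- nondecreasing in t.  Take groups of B ≈ √(N/l) consecutive windows, and call a group settled at t
-- if Φ_t is the same at both its ends, hence on all of it.  When the common value is odd, the answers
-- of the group depend, given Φ, on the elements from t on only; when it is even, on those before t
-- only.  As Φ_t is monotone, at most 2l groups are unsettled at any t, so there is room to
-- keep for each of them the at most 2B elements since its last settled time that lie in some but
-- not all of its windows, and the l smallest of those that lie in all.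
--
-- The first pass finds the l smallest elements of every B-th window, which determine Φ_t at the
-- ends of all groups for every t.  A group is written in full at the first t at which it is settled with
-- an even value 2r, in the pass number r after the first.  For a fixed r these times are monotone in the
-- group, which makes the output of each pass increasing.

open import Defs
open import Data.Bool.Base using (Bool; true; false)
open import Data.Empty using (⊥-elim)
open import Data.Fin.Base as Fin using (Fin; toℕ; fromℕ<)
open import Data.Fin.Properties using (toℕ<n; toℕ-injective; toℕ-fromℕ<; ≤-decTotalOrder)
open import Data.List.Base
  using (List; []; _∷_; _++_; length; take; drop; head; map; filter; foldr; concat; allFin; applyUpTo)
open import Data.List.Properties
  using (length-++; length-map; length-take; length-filter; length-tabulate; take++drop≡id; ++-assoc;
         map-++; map-∘; map-id; map-applyUpTo; filter-++; filter-accept; filter-reject; filter-≐;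
         filter-all; filter-none)
import Data.List.Sort as Sort
open import Data.List.Relation.Unary.All as All using (All; []; _∷_)
import Data.List.Relation.Unary.All.Properties as Allₚ
open import Data.List.Relation.Unary.AllPairs using (AllPairs; []; _∷_)
import Data.List.Relation.Unary.AllPairs.Properties as AllPairsₚ
open import Data.List.Relation.Unary.Any as Any using (Any; here; there)
open import Data.List.Relation.Unary.Linked using (Linked)
open import Data.List.Relation.Unary.Linked.Properties using (AllPairs⇒Linked; Linked⇒AllPairs)
open import Data.List.Relation.Binary.Permutation.Propositional
  using (_↭_; ↭-refl; ↭-reflexive; ↭-sym; ↭-trans; ↭-prep; ↭-swap)
open import Data.List.Relation.Binary.Permutation.Propositional.Properties
  using (filter-↭; ↭-length; All-resp-↭; shift; ++⁺)
open import Data.Maybe.Base using (just)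
open import Data.Nat.Base
open import Data.Nat.DivMod using (_/_; m/n*n≤m; m%n<n; m≡m%n+[m/n]*n; m<n*o⇒m/o<n; /-monoˡ-≤)
open import Data.Nat.Induction using (<-rec)
open import Data.Nat.ListAction using (sum)
open import Data.Nat.Logarithm using (⌈log₂_⌉; ⌈log₂⌉-mono-≤; ⌈log₂⌈n/2⌉⌉≡⌈log₂n⌉∸1)
open import Data.Nat.Properties hiding (≤-decTotalOrder)
open import Data.Nat.Solver using (module +-*-Solver)
open import Data.Product.Base using (_×_; _,_; proj₁; proj₂; map₁; ∃-syntax)
open import Data.Sum.Base using (_⊎_; inj₁; inj₂; [_,_]′)
open import Data.Vec.Base as Vec using (Vec)
open import Data.Vec.Properties using (length-toList)
open import Function.Base using (_∘_; id)
open import Relation.Binary.PropositionalEquality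
  using (_≡_; refl; sym; trans; cong; cong₂; subst; module ≡-Reasoning)
open import Relation.Nullary.Decidable using (Dec; yes; no; ¬?; _→-dec_; _×-dec_; _⊎-dec_)
open import Relation.Nullary.Negation using (¬_; contradiction)
open import Relation.Unary using (Decidable)

-- Counting below a bound

-- Let s be the last settled time of a group before its first time t of being settled at an even
-- value, with levels 2c+1 at s and 2r at t. For every window of the group the answer is then the
-- (r-c)-th smallest of its elements between s and t; the two numbers c and r replace everything
-- outside that interval. Apart from these elements nothing is stored per group: settled times,
-- writing times and pass numbers are functions of the summaries and the current time, and are
-- recomputed when required. Every level is 1 at time 0 and 2l at time N, so s and t always exist
-- and r is one of 1, ..., l; this is where the l output passes come from. A later group has levels
-- that are no larger and may be written earlier in the input, but only with a smaller r, so
-- separating the values of r restores the order. Ties in value go to the earlier position: with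
-- another rule the l smallest elements of a window need not determine its levels. The space is
-- dominated by the l elements kept for each of about lB grid windows.

# : {P : ℕ → Set} → Decidable P → ℕ → ℕ
# P? zero = 0
# P? (suc n) with P? n
... | yes _ = suc (# P? n)
... | no _ = # P? n

module _ {P : ℕ → Set} (P? : Decidable P) where

  #-yes : ∀ {n} → P n → # P? (suc n) ≡ suc (# P? n)
  #-yes {n} p with P? n
  ... | yes _ = refl
  ... | no ¬p = contradiction p ¬p

  #-no : ∀ {n} → ¬ P n → # P? (suc n) ≡ # P? n
  #-no {n} ¬p with P? n
  ... | yes p = contradiction p ¬p
  ... | no _ = refl

  #-≤ : ∀ n → # P? n ≤ n
  #-≤ zero = z≤n
  #-≤ (suc n) with P? n
  ... | yes _ = s≤s (#-≤ n)
  ... | no _ = m≤n⇒m≤1+n (#-≤ n)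

  #-within : ∀ {u e} → (∀ {p} → P p → u ≤ p × p < e) → ∀ n → # P? n ≤ (n ⊓ e) ∸ u
  #-within sub zero = z≤n
  #-within {u} {e} sub (suc n) with P? n
  ... | no _ = ≤-trans (#-within sub n) (∸-monoˡ-≤ u (⊓-monoˡ-≤ e (n≤1+n n)))
  ... | yes p with sub p
  ...   | u≤n , n<e = begin
    suc (# P? n)      ≤⟨ s≤s (#-within sub n) ⟩
    suc ((n ⊓ e) ∸ u) ≡⟨ cong (λ z → suc (z ∸ u)) (m≤n⇒m⊓n≡m (<⇒≤ n<e)) ⟩
    suc (n ∸ u)       ≡⟨ sym (+-∸-assoc 1 u≤n) ⟩
    suc n ∸ u         ≡⟨ cong (_∸ u) (sym (m≤n⇒m⊓n≡m n<e)) ⟩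
    (suc n ⊓ e) ∸ u   ∎
    where open ≤-Reasoning

  #-contains : ∀ {u e} → (∀ {p} → u ≤ p → p < e → P p) → ∀ n → (n ⊓ e) ∸ u ≤ # P? n
  #-contains {u} sup zero = ≤-reflexive (0∸n≡0 u)
  #-contains {u} {e} sup (suc n) with P? n
  ... | yes _ = begin
    (suc n ⊓ e) ∸ u   ≤⟨ ∸-monoˡ-≤ u (⊓-monoʳ-≤ (suc n) (n≤1+n e)) ⟩
    suc (n ⊓ e) ∸ u   ≤⟨ suc-∸ (n ⊓ e) u ⟩
    suc ((n ⊓ e) ∸ u) ≤⟨ s≤s (#-contains sup n) ⟩
    suc (# P? n)      ∎
    where
      open ≤-Reasoning
      suc-∸ : ∀ a b → suc a ∸ b ≤ suc (a ∸ b)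
      suc-∸ a zero = ≤-refl
      suc-∸ zero (suc b) = ≤-trans (≤-reflexive (0∸n≡0 b)) z≤n
      suc-∸ (suc a) (suc b) = suc-∸ a b
  ... | no ¬p with e ≤? n
  ...   | yes e≤n = ≤-trans (≤-reflexive (cong (_∸ u)
            (trans (m≥n⇒m⊓n≡n (m≤n⇒m≤1+n e≤n)) (sym (m≥n⇒m⊓n≡n e≤n))))) (#-contains sup n)
  ...   | no e≰n = ≤-trans (≤-reflexive (m≤n⇒m∸n≡0 (≤-trans (m⊓n≤m (suc n) e) n<u))) z≤n
    where
      n<u : n < u
      n<u = ≰⇒> λ u≤n → ¬p (sup u≤n (≰⇒> e≰n))

  #-none : ∀ n → (∀ {p} → p < n → ¬ P p) → # P? n ≡ 0
  #-none zero none = refl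
  #-none (suc n) none = trans (#-no (none ≤-refl)) (#-none n (none ∘ m≤n⇒m≤1+n))

  #-all : ∀ n → (∀ {p} → p < n → P p) → # P? n ≡ n
  #-all zero all = refl
  #-all (suc n) all = trans (#-yes (all ≤-refl)) (cong suc (#-all n (all ∘ m≤n⇒m≤1+n)))

  #-cut : ∀ {m n} → m ≤ n → (∀ {p} → P p → p < m) → # P? n ≡ # P? m
  #-cut {n = zero} z≤n sub = refl
  #-cut {m} {suc n} m≤1+n sub with m≤n⇒m<n∨m≡n m≤1+n
  ... | inj₂ refl = refl
  ... | inj₁ m<1+n = trans (#-no λ p → <⇒≱ (sub p) (s≤s⁻¹ m<1+n)) (#-cut (s≤s⁻¹ m<1+n) sub)

  module _ (down : ∀ {m} → P (suc m) → P m) where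

    -- A downward closed predicate holds exactly on an initial segment, so counting its instances
    -- below n finds the point where it stops. `Φ` is read off from `Chain` in this way.
    down* : ∀ {m n} → m ≤ n → P n → P m
    down* {n = zero} z≤n p = p
    down* {m} {suc n} m≤1+n p with m ≟ suc n
    ... | yes refl = p
    ... | no m≢1+n = down* (s≤s⁻¹ (≤∧≢⇒< m≤1+n m≢1+n)) (down p)

    #-initial : ∀ n {m} → m < # P? n → P m
    #-initial (suc n) m<# with P? n
    ... | yes p = down* (s≤s⁻¹ (≤-trans m<# (s≤s (#-≤ n)))) p
    ... | no _ = #-initial n m<#

    #-initial⁻¹ : ∀ n {m} → m < n → P m → m < # P? n
    #-initial⁻¹ (suc n) {m} m<1+n pm with P? n
    ... | yes p = ≤-trans m<1+n (s≤s (≤-reflexive (sym (#-all n λ q<n → down* (<⇒≤ q<n) p))))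
    ... | no ¬p = #-initial⁻¹ n (≤∧≢⇒< (s≤s⁻¹ m<1+n) λ { refl → ¬p pm }) pm

module _ {P Q : ℕ → Set} (P? : Decidable P) (Q? : Decidable Q) where

  #-mono : ∀ n → (∀ {p} → p < n → P p → Q p) → # P? n ≤ # Q? n
  #-mono zero sub = z≤n
  #-mono (suc n) sub with P? n | Q? n
  ... | yes _ | yes _ = s≤s (#-mono n (sub ∘ m≤n⇒m≤1+n))
  ... | yes p | no ¬q = contradiction (sub ≤-refl p) ¬q
  ... | no _ | yes _ = m≤n⇒m≤1+n (#-mono n (sub ∘ m≤n⇒m≤1+n))
  ... | no _ | no _ = #-mono n (sub ∘ m≤n⇒m≤1+n)

#-cong : ∀ {P Q : ℕ → Set} (P? : Decidable P) (Q? : Decidable Q) n →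
         (∀ {p} → p < n → P p → Q p) → (∀ {p} → p < n → Q p → P p) → # P? n ≡ # Q? n
#-cong P? Q? n to from = ≤-antisym (#-mono P? Q? n to) (#-mono Q? P? n from)

#-partition : ∀ {P Q S : ℕ → Set} (P? : Decidable P) (Q? : Decidable Q) (S? : Decidable S) n →
  (∀ {p} → p < n → S p → P p ⊎ Q p) → (∀ {p} → p < n → P p → S p) → (∀ {p} → p < n → Q p → S p) →
  (∀ {p} → P p → ¬ Q p) → # S? n ≡ # P? n + # Q? n
#-partition P? Q? S? zero split inP inQ disj = refl
#-partition P? Q? S? (suc n) split inP inQ disj with
  #-partition P? Q? S? n (split ∘ m≤n⇒m≤1+n) (inP ∘ m≤n⇒m≤1+n) (inQ ∘ m≤n⇒m≤1+n) disj
... | ih with P? n | Q? n | S? n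
... | yes p | yes q | _ = contradiction q (disj p)
... | yes p | no _ | yes _ = cong suc ih
... | no _ | yes _ | yes _ = trans (cong suc ih) (sym (+-suc _ _))
... | no ¬p | no ¬q | yes s = contradiction (split ≤-refl s) [ ¬p , ¬q ]′
... | yes p | no _ | no ¬s = contradiction (inP ≤-refl p) ¬s
... | no _ | yes q | no ¬s = contradiction (inQ ≤-refl q) ¬s
... | no _ | no _ | no _ = ih

-- Levels of a pair of multisets

-- A multiset of values in [0,R] is given by its counting function v ↦ #{x ≤ v}; Dom R k j f g says
-- that the k-th smallest of f is at most the j-th smallest of g (∞ if there is none).
Dom : ℕ → ℕ → ℕ → (ℕ → ℕ) → (ℕ → ℕ) → Set
Dom R k j f g = ∀ {v} → v < suc R → j ≤ g v → k ≤ f v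

dom? : ∀ R k j f g → Dec (Dom R k j f g)
dom? R k j f g = allUpTo? (λ v → (j ≤? g v) →-dec (k ≤? f v)) (suc R)

m<2l⇒⌊m/2⌋<l : ∀ {m l} → m < l + l → ⌊ m /2⌋ < l
m<2l⇒⌊m/2⌋<l {m} m<2l = ≰⇒> λ l≤ → <⇒≱ m<2l
  (≤-trans (+-mono-≤ l≤ (≤-trans l≤ (⌊n/2⌋≤⌈n/2⌉ m))) (≤-reflexive (⌊n/2⌋+⌈n/2⌉≡n m)))

-- Chain R l f g (m + 1) implies Chain R l f g m, so the number Φ of the true ones among the first 2l
-- is 2c if the l-th smallest of f and g together is the c-th smallest of f, and 2c+1 if it is the
-- (l-c)-th smallest of g.  Ties go to f.
Chain : ℕ → ℕ → (ℕ → ℕ) → (ℕ → ℕ) → ℕ → Set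
Chain R l f g m = Dom R ⌈ m /2⌉ (l ∸ ⌊ m /2⌋) f g

chain? : ∀ R l f g → Decidable (Chain R l f g)
chain? R l f g m = dom? R ⌈ m /2⌉ (l ∸ ⌊ m /2⌋) f g

opaque

  Φ : ℕ → ℕ → (ℕ → ℕ) → (ℕ → ℕ) → ℕ
  Φ R l f g = # (chain? R l f g) (l + l)

  Φ-mono : ∀ R l {f f′ g g′} → (∀ v → f v ≤ f′ v) → (∀ v → g′ v ≤ g v) → Φ R l f g ≤ Φ R l f′ g′
  Φ-mono R l f≤f′ g′≤g = #-mono (chain? R l _ _) (chain? R l _ _) (l + l)
    λ _ chain v< j≤ → ≤-trans (chain v< (≤-trans j≤ (g′≤g _))) (f≤f′ _)

  Φ≤2l : ∀ R l f g → Φ R l f g ≤ l + l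
  Φ≤2l R l f g = #-≤ (chain? R l f g) (l + l)

  chain-down : ∀ R l f g {m} → Chain R l f g (suc m) → Chain R l f g m
  chain-down R l f g {m} chain v< j≤ =
    ≤-trans (⌈n/2⌉-mono (n≤1+n m))
      (chain v< (≤-trans (∸-monoʳ-≤ l (⌊n/2⌋-mono (n≤1+n m))) j≤))

  Φ-chain : ∀ R l f g {m} → m < Φ R l f g → Chain R l f g m
  Φ-chain R l f g = #-initial (chain? R l f g) (chain-down R l f g) (l + l)

  Φ-¬chain : ∀ R l f g {m} → m < l + l → Φ R l f g ≤ m → ¬ Chain R l f g m
  Φ-¬chain R l f g m< Φ≤m chain =
    <⇒≱ (#-initial⁻¹ (chain? R l f g) (chain-down R l f g) (l + l) m< chain) Φ≤m

  1≤Φ : ∀ R l f g → 1 ≤ l → 1 ≤ Φ R l f g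
  1≤Φ R l f g 1≤l = #-initial⁻¹ (chain? R l f g) (chain-down R l f g) (l + l)
    (≤-trans 1≤l (m≤m+n l l)) λ _ _ → z≤n

  -- Below 2l the required rank `l ∸ ⌊ m /2⌋` in g is positive, so with g empty every `Chain` holds
  -- vacuously.
  Φ-gempty : ∀ R l f g → (∀ v → g v ≡ 0) → Φ R l f g ≡ l + l
  Φ-gempty R l f g g≡0 = #-all (chain? R l f g) (l + l) λ {m} m< {v} _ j≤ →
    contradiction (subst (l ∸ ⌊ m /2⌋ ≤_) (g≡0 v) j≤) (<⇒≱ (m<n⇒0<n∸m (m<2l⇒⌊m/2⌋<l m<)))

  -- `Chain` at 0 asks for nothing, while at 1 it asks for an element of f below the l-th of g, and
  -- fails at the value R.
  Φ-fempty : ∀ R l f g → 1 ≤ l → (∀ v → f v ≡ 0) → l ≤ g R → Φ R l f g ≡ 1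
  Φ-fempty R l f g 1≤l f≡0 l≤g = ≤-antisym
    (≮⇒≥ λ 1<Φ → <⇒≱ (s≤s z≤n) (≤-trans (Φ-chain R l f g 1<Φ ≤-refl l≤g) (≤-reflexive (f≡0 R))))
    (1≤Φ R l f g 1≤l)

-- x, y, z are the parts of a window before a time s, between s and a later time t, and after t,
-- where Φ is odd, 2c+1, at s and even, 2(c+d), at t; l = c + d + e.  Then y alone decides.
middle-decides : ∀ R c d e (x y z : ℕ → ℕ) →
  (∀ {v w} → v ≤ w → x v ≤ x w) → (∀ {v w} → v ≤ w → y v ≤ y w) → (∀ {v w} → v ≤ w → z v ≤ z w) →
  Dom R c (d + e) x (λ v → y v + z v) → ¬ Dom R (suc c) (d + e) x (λ v → y v + z v) →
  Dom R (c + d) (suc e) (λ v → x v + y v) z → (e ≡ 0 ⊎ ¬ Dom R (c + d) e (λ v → x v + y v) z) →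
  ∀ {v} → v < suc R →
  (d ≤ y v → c + d + e ≤ x v + y v + z v) × (c + d + e ≤ x v + y v + z v → d ≤ y v)
middle-decides R c d e x y z x↗ y↗ z↗ A₁ A₂ B₁ B₂ {v} v< = to , from
  where
    enough : d ≤ y v → e ≤ z v → c + d + e ≤ x v + y v + z v
    enough d≤ e≤ = +-mono-≤ (+-mono-≤ (A₁ v< (+-mono-≤ d≤ e≤)) d≤) e≤

    to : d ≤ y v → c + d + e ≤ x v + y v + z v
    to d≤ with e ≤? z v
    ... | yes e≤ = enough d≤ e≤
    ... | no e≰ = ⊥-elim ([ (λ { refl → e≰ z≤n }) , (λ ¬dom → ¬dom dom) ]′ B₂)
      where
        -- With fewer than e elements of z up to v, any w with `e ≤ z w` lies above v, where y
        -- already has d elements; `A₁` then adds c from x. This would push the level at t above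
        -- 2(c+d).
        dom : Dom R (c + d) e (λ v → x v + y v) z
        dom w< e≤ = +-mono-≤ (A₁ w< (+-mono-≤ d≤w e≤)) d≤w
          where d≤w = ≤-trans d≤ (y↗ (≮⇒≥ λ w<v → e≰ (≤-trans e≤ (z↗ (<⇒≤ w<v)))))

    z-large : ∀ {a b} → a < d → d + e ≤ a + b → suc e ≤ b
    z-large {a} {b} a<d le = +-cancelˡ-≤ a (suc e) b (≤-trans
      (≤-trans (≤-reflexive (+-suc a e)) (+-monoˡ-≤ e a<d)) le)

    y-large : ∀ {a b} → a ≤ c → c + d ≤ a + b → d ≤ b
    y-large {a} {b} a≤c le = +-cancelˡ-≤ c d b (≤-trans le (+-monoˡ-≤ b a≤c))

    from : c + d + e ≤ x v + y v + z v → d ≤ y v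
    from l≤ with d ≤? y v
    ... | yes d≤ = d≤
    ... | no d≰ = ⊥-elim (A₂ dom)
      where
        -- Suppose x has at most c elements up to w. At the smaller of v and w, x has at most c, y
        -- fewer than d, and y and z together at least d + e. So z has more than e there, and `B₁`
        -- forces y up to d after all.
        dom : Dom R (suc c) (d + e) x (λ v → y v + z v)
        dom {w} w< le with suc c ≤? x w
        ... | yes c< = c<
        ... | no c≮ with ≤-total v w
        ...   | inj₁ v≤w = contradiction
          (y-large xv≤c (B₁ v< (z-large (≰⇒> d≰) (+-cancelˡ-≤ c _ _ (≤-trans
            (≤-trans (≤-reflexive (sym (+-assoc c d e))) l≤)
            (≤-trans (≤-reflexive (+-assoc (x v) (y v) (z v))) (+-monoˡ-≤ _ xv≤c))))))) d≰
          where
            xv≤c : x v ≤ c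
            xv≤c = ≤-trans (x↗ v≤w) (≮⇒≥ c≮)
        ...   | inj₂ w≤v = contradiction
          (≤-trans (y-large (≮⇒≥ c≮) (B₁ w< (z-large (≤-<-trans (y↗ w≤v) (≰⇒> d≰)) le))) (y↗ w≤v)) d≰

-- Counting in lists, and the smallest elements of a list

ct : ∀ {X : Set} {P : X → Set} → Decidable P → List X → ℕ
ct P? xs = length (filter P? xs)

module _ {X : Set} {P : X → Set} (P? : Decidable P) where

  ct-↭ : ∀ {xs ys} → xs ↭ ys → ct P? xs ≡ ct P? ys
  ct-↭ = ↭-length ∘ filter-↭ P?

  ct-take-drop : ∀ l xs → ct P? xs ≡ ct P? (take l xs) + ct P? (drop l xs)
  ct-take-drop l xs = begin
    ct P? xs                           ≡⟨ cong (ct P?) (sym (take++drop≡id l xs)) ⟩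
    ct P? (take l xs ++ drop l xs)     ≡⟨ cong length (filter-++ P? (take l xs) (drop l xs)) ⟩
    length (filter P? (take l xs) ++ filter P? (drop l xs))
                                       ≡⟨ length-++ (filter P? (take l xs)) ⟩
    ct P? (take l xs) + ct P? (drop l xs) ∎
    where open ≡-Reasoning

  ct-pos : ∀ xs → 0 < ct P? xs → Any P xs
  ct-pos (x ∷ xs) 0<ct with P? x
  ... | yes p = here p
  ... | no _ = there (ct-pos xs 0<ct)

  ct-all : ∀ {xs} → All P xs → ct P? xs ≡ length xs
  ct-all all = cong length (filter-all P? all)

  ct-none : ∀ {xs} → All (¬_ ∘ P) xs → ct P? xs ≡ 0
  ct-none none = cong length (filter-none P? none)

module _ {X : Set} {P Q : X → Set} (P? : Decidable P) (Q? : Decidable Q) where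

  ct-mono : ∀ {xs} → All (λ x → P x → Q x) xs → ct P? xs ≤ ct Q? xs
  ct-mono [] = z≤n
  ct-mono {x ∷ xs} (f ∷ fs) with P? x | Q? x
  ... | yes _ | yes _ = s≤s (ct-mono fs)
  ... | yes p | no ¬q = contradiction (f p) ¬q
  ... | no _ | yes _ = m≤n⇒m≤1+n (ct-mono fs)
  ... | no _ | no _ = ct-mono fs

  ct-complement : ∀ xs → (∀ x → P x ⊎ Q x) → (∀ x → P x → ¬ Q x) → ct P? xs + ct Q? xs ≡ length xs
  ct-complement [] split disj = refl
  ct-complement (x ∷ xs) split disj with P? x | Q? x
  ... | yes p | yes q = contradiction q (disj x p)
  ... | yes _ | no _ = cong suc (ct-complement xs split disj)
  ... | no _ | yes _ = trans (+-suc _ _) (cong suc (ct-complement xs split disj))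
  ... | no ¬p | no ¬q = contradiction (split x) [ ¬p , ¬q ]′

length-take-full : ∀ {X : Set} {P : X → Set} l (xs : List X) → Any P (drop l xs) → length (take l xs) ≡ l
length-take-full zero xs any = refl
length-take-full (suc l) (x ∷ xs) any = cong suc (length-take-full l xs any)

-- (position, value)
Item : Set
Item = ℕ × ℕ

-- The position breaks ties to match `Φ`, whose ties go to the part before t.
_⊴_ : Item → Item → Set
(p , a) ⊴ (q , b) = a < b ⊎ (a ≡ b × p ≤ q)

_⊴?_ : ∀ x y → Dec (x ⊴ y)
(p , a) ⊴? (q , b) = (a <? b) ⊎-dec ((a ≟ b) ×-dec (p ≤? q))

⊴-trans : ∀ {x y z} → x ⊴ y → y ⊴ z → x ⊴ z
⊴-trans (inj₁ a<b) (inj₁ b<c) = inj₁ (<-trans a<b b<c)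
⊴-trans (inj₁ a<b) (inj₂ (refl , _)) = inj₁ a<b
⊴-trans (inj₂ (refl , _)) (inj₁ b<c) = inj₁ b<c
⊴-trans (inj₂ (refl , p≤q)) (inj₂ (refl , q≤r)) = inj₂ (refl , ≤-trans p≤q q≤r)

⊴-total : ∀ {x y} → ¬ (x ⊴ y) → y ⊴ x
⊴-total {p , a} {q , b} ¬x⊴y with <-≤-connex b a
... | inj₁ b<a = inj₁ b<a
... | inj₂ a≤b with m≤n⇒m<n∨m≡n a≤b
...   | inj₁ a<b = contradiction (inj₁ a<b) ¬x⊴y
...   | inj₂ refl = inj₂ (refl , <⇒≤ (≰⇒> (λ p≤q → ¬x⊴y (inj₂ (refl , p≤q)))))

⊴⇒≤ : ∀ {x y} → x ⊴ y → proj₂ x ≤ proj₂ y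
⊴⇒≤ (inj₁ a<b) = <⇒≤ a<b
⊴⇒≤ (inj₂ (refl , _)) = ≤-refl

insert : Item → List Item → List Item
insert x [] = x ∷ []
insert x (y ∷ ys) with x ⊴? y
... | yes _ = x ∷ y ∷ ys
... | no _ = y ∷ insert x ys

isort : List Item → List Item
isort = foldr insert []

Sorted : List Item → Set
Sorted = AllPairs _⊴_

insert-↭ : ∀ x ys → insert x ys ↭ x ∷ ys
insert-↭ x [] = ↭-refl
insert-↭ x (y ∷ ys) with x ⊴? y
... | yes _ = ↭-refl
... | no _ = ↭-trans (↭-prep y (insert-↭ x ys)) (↭-swap y x ↭-refl)

insert-sorted : ∀ x {ys} → Sorted ys → Sorted (insert x ys)
insert-sorted x [] = [] ∷ []
insert-sorted x {y ∷ ys} (y⊴ ∷ s) with x ⊴? y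
... | yes x⊴y = (x⊴y ∷ All.map (⊴-trans x⊴y) y⊴) ∷ y⊴ ∷ s
... | no x⋬y = All-resp-↭ (↭-sym (insert-↭ x ys)) (⊴-total x⋬y ∷ y⊴) ∷ insert-sorted x s

-- What stands beyond place l can only be pushed further back by an insertion. Hence the l smallest
-- items can be maintained online from l stored ones.
take-insert : ∀ l x ys → take l (insert x (take l ys)) ≡ take l (insert x ys)
take-insert zero x ys = refl
take-insert (suc l) x [] = refl
take-insert (suc l) x (y ∷ ys) with x ⊴? y
... | yes _ = cong (x ∷_) (take-take l)
  where
    take-take : ∀ l → take l (y ∷ take l ys) ≡ take l (y ∷ ys)
    take-take zero = refl
    take-take (suc l) = cong (y ∷_) (go l ys)
      where
        go : ∀ l ys → take l (take (suc l) ys) ≡ take l ys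
        go zero ys = refl
        go (suc l) [] = refl
        go (suc l) (y ∷ ys) = cong (y ∷_) (go l ys)
... | no _ = cong (y ∷_) (take-insert l x ys)

isort-↭ : ∀ xs → isort xs ↭ xs
isort-↭ [] = ↭-refl
isort-↭ (x ∷ xs) = ↭-trans (insert-↭ x (isort xs)) (↭-prep x (isort-↭ xs))

isort-sorted : ∀ xs → Sorted (isort xs)
isort-sorted [] = []
isort-sorted (x ∷ xs) = insert-sorted x (isort-sorted xs)

take⊴drop : ∀ l {xs} → Sorted xs → All (λ x → All (x ⊴_) (drop l xs)) (take l xs)
take⊴drop zero _ = []
take⊴drop (suc l) [] = []
take⊴drop (suc l) (x⊴ ∷ s) = Allₚ.drop⁺ l x⊴ ∷ take⊴drop l s

-- Keeping only the l smallest items does not change the level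

Below Above : ℕ → ℕ → Item → Set
Below t v (p , a) = p < t × a ≤ v
Above t v (p , a) = t ≤ p × a ≤ v

below? : ∀ t v → Decidable (Below t v)
below? t v (p , a) = (p <? t) ×-dec (a ≤? v)

above? : ∀ t v → Decidable (Above t v)
above? t v (p , a) = (t ≤? p) ×-dec (a ≤? v)

lo hi : ℕ → List Item → ℕ → ℕ
lo t xs v = ct (below? t v) xs
hi t xs v = ct (above? t v) xs

atMost? : ∀ v → Decidable (λ (x : Item) → proj₂ x ≤ v)
atMost? v x = proj₂ x ≤? v

level : ℕ → ℕ → ℕ → List Item → ℕ
level R l t xs = Φ R l (lo t xs) (hi t xs)

module _ (l : ℕ) {xs : List Item} (sorted : Sorted xs) where

  private
    S D : List Item
    S = take l xs
    D = drop l xs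

  -- Either no dropped item is at most v, and nothing is lost, or all l kept items are at most v and
  -- already reach any threshold up to l.
  take-atMost : ∀ {k a v} → k ≤ l → k ≤ a + ct (atMost? v) xs → k ≤ a + ct (atMost? v) S
  take-atMost {k} {a} {v} k≤l k≤ with 0 <? ct (atMost? v) D
  ... | no D≡0 = subst (λ z → k ≤ a + z) (trans (ct-take-drop (atMost? v) l xs)
    (trans (cong (ct (atMost? v) S +_) (n≤0⇒n≡0 (≮⇒≥ D≡0))) (+-identityʳ _))) k≤
  ... | yes D>0 = begin
    k                      ≤⟨ k≤l ⟩
    l                      ≡⟨ sym (length-take-full l xs some) ⟩
    length S               ≡⟨ sym (ct-all (atMost? v) (All.map small (take⊴drop l sorted))) ⟩
    ct (atMost? v) S       ≤⟨ m≤n+m _ a ⟩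
    a + ct (atMost? v) S   ∎
    where
      open ≤-Reasoning
      some : Any (λ x → proj₂ x ≤ v) D
      some = ct-pos (atMost? v) D D>0
      small : ∀ {x} → All (x ⊴_) D → proj₂ x ≤ v
      small x⊴ with All.lookupAny x⊴ some
      ... | x⊴y , y≤v = ≤-trans (⊴⇒≤ x⊴y) y≤v

  module _ (t : ℕ) where

    private
      before? : Decidable (λ (x : Item) → proj₁ x < t)
      before? x = proj₁ x <? t
      after? : Decidable (λ (x : Item) → t ≤ proj₁ x)
      after? x = t ≤? proj₁ x

      la lb : ℕ
      la = ct before? S
      lb = ct after? S

      la+lb : ∀ {P : Item → Set} → Any P D → la + lb ≡ l
      la+lb some = trans
        (ct-complement before? after? S (λ x → <-≤-connex (proj₁ x) t) (λ _ → <⇒≱))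
        (length-take-full l xs some)

      lo-saturates : ∀ {v} → Any (λ x → proj₂ x ≤ v) D → la ≤ lo t S v
      lo-saturates {v} some = ct-mono before? (below? t v) (All.map small (take⊴drop l sorted))
        where
          small : ∀ {x} → All (x ⊴_) D → proj₁ x < t → Below t v x
          small x⊴ p<t with All.lookupAny x⊴ some
          ... | x⊴y , y≤v = p<t , ≤-trans (⊴⇒≤ x⊴y) y≤v

      hi-saturates : ∀ {v} → Any (Above t v) D → lb ≤ hi t S v
      hi-saturates {v} some = ct-mono after? (above? t v) (All.map small (take⊴drop l sorted))
        where
          small : ∀ {x} → All (x ⊴_) D → t ≤ proj₁ x → Above t v x
          small x⊴ t≤p with All.lookupAny x⊴ some
          ... | x⊴y , _ , y≤v = t≤p , ≤-trans (⊴⇒≤ x⊴y) y≤v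

      -- A kept item after t cannot tie with a dropped one before t, since the tie would have
      -- favoured the earlier; hence the strict inequality.
      later-smaller : ∀ {v} {x : Item} → Any (Below t v) D → All (x ⊴_) D → t ≤ proj₁ x → proj₂ x < v
      later-smaller some x⊴ t≤p with All.lookupAny x⊴ some
      ... | inj₁ a<b , _ , b≤v = <-≤-trans a<b b≤v
      ... | inj₂ (_ , p≤q) , q<t , _ = contradiction (≤-<-trans p≤q q<t) (≤⇒≯ t≤p)

      lb≤0 : Any (Below t 0) D → lb ≤ 0
      lb≤0 some = ≤-reflexive (ct-none after?
        (All.map (λ x⊴ t≤p → contradiction (later-smaller some x⊴ t≤p) λ ()) (take⊴drop l sorted)))

      hi-saturates-below : ∀ {v} → Any (Below t (suc v)) D → lb ≤ hi t S v
      hi-saturates-below {v} some = ct-mono after? (above? t v)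
        (All.map (λ x⊴ t≤p → t≤p , s≤s⁻¹ (later-smaller some x⊴ t≤p)) (take⊴drop l sorted))

      lo-split : ∀ v → lo t xs v ≡ lo t S v + lo t D v
      lo-split v = ct-take-drop (below? t v) l xs

      hi-split : ∀ v → hi t xs v ≡ hi t S v + hi t D v
      hi-split v = ct-take-drop (above? t v) l xs

      j≤lb : ∀ {k j} {P : Item → Set} → Any P D → k + j ≤ suc l → la < k → j ≤ lb
      j≤lb {k} {j} some k+j≤ la<k = +-cancelˡ-≤ (suc la) j lb (≤-trans (+-monoˡ-≤ j la<k)
        (≤-trans k+j≤ (s≤s (≤-reflexive (sym (la+lb some))))))

    -- If some dropped item after t is at most v, all kept items are, so the kept counts have
    -- reached their totals la and lb, where la + lb = l. From k + j ≤ l + 1 follows k ≤ la or j ≤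
    -- lb; the second case feeds the hypothesis on the kept items.
    dom-extend : ∀ {R k j} → k + j ≤ suc l → Dom R k j (lo t S) (hi t S) → Dom R k j (lo t xs) (hi t xs)
    dom-extend {R} {k} {j} k+j≤ dom {v} v< j≤ with 0 <? hi t D v
    ... | no D≡0 = ≤-trans (dom v< (subst (j ≤_) (trans (hi-split v)
      (trans (cong (hi t S v +_) (n≤0⇒n≡0 (≮⇒≥ D≡0))) (+-identityʳ _))) j≤))
      (≤-trans (m≤m+n _ _) (≤-reflexive (sym (lo-split v))))
    ... | yes D>0 with ct-pos (above? t v) D D>0
    ...   | some with k ≤? lo t S v
    ...     | yes k≤ = ≤-trans k≤ (≤-trans (m≤m+n _ _) (≤-reflexive (sym (lo-split v))))
    ...     | no k≰ = contradiction (dom v< (≤-trans (j≤lb some k+j≤ la<k) (hi-saturates some))) k≰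
      where
        la<k : la < k
        la<k = ≤-<-trans (lo-saturates (Any.map proj₂ some)) (≰⇒> k≰)

    -- The dangerous case is a dropped item before t with value at most v. Kept items after t then
    -- lie strictly below v, so the premise already holds at v - 1 and the argument descends. At v =
    -- 0 no kept item after t is left, against 1 ≤ j.
    dom-restrict : ∀ {R k j} → k + j ≤ suc l → 1 ≤ j →
                   Dom R k j (lo t xs) (hi t xs) → Dom R k j (lo t S) (hi t S)
    dom-restrict {R} {k} {j} k+j≤ 1≤j dom {v} v< j≤ with 0 <? lo t D v
    ... | no D≡0 = subst (k ≤_) (trans (lo-split v)
      (trans (cong (lo t S v +_) (n≤0⇒n≡0 (≮⇒≥ D≡0))) (+-identityʳ _)))
      (dom v< (≤-trans j≤ (≤-trans (m≤m+n _ _) (≤-reflexive (sym (hi-split v))))))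
    ... | yes D>0 with ct-pos (below? t v) D D>0
    ...   | some with k ≤? lo t S v
    ...     | yes k≤ = k≤
    ...     | no k≰ = step v v< some refl
      where
        la<k : la < k
        la<k = ≤-<-trans (lo-saturates (Any.map proj₂ some)) (≰⇒> k≰)
        step : ∀ w → w < suc R → Any (Below t w) D → v ≡ w → k ≤ lo t S v
        step zero w< some₀ refl = contradiction
          (≤-trans 1≤j (≤-trans (j≤lb some k+j≤ la<k) (lb≤0 some₀))) λ ()
        step (suc w) w< someₛ refl = ≤-trans
          (dom-restrict k+j≤ 1≤j dom (<⇒≤ w<) (≤-trans (j≤lb some k+j≤ la<k) (hi-saturates-below someₛ)))
          (ct-mono (below? t w) (below? t (suc w)) (All.universal (λ _ (p<t , a≤) → p<t , m≤n⇒m≤1+n a≤) S))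

    opaque
      unfolding Φ

      -- Every `Chain` with m < 2l compares ranks k and j with k + j ≤ l + 1, and such a comparison
      -- is settled by the l smallest items.
      level-take : ∀ R → level R l t S ≡ level R l t xs
      level-take R = #-cong (chain? R l _ _) (chain? R l _ _) (l + l)
        (λ {m} m< → dom-extend (k+j≤ m m<))
        (λ {m} m< → dom-restrict (k+j≤ m m<) (m<n⇒0<n∸m (m<2l⇒⌊m/2⌋<l m<)))
        where
          k+j≤ : ∀ m → m < l + l → ⌈ m /2⌉ + (l ∸ ⌊ m /2⌋) ≤ suc l
          k+j≤ m m< = ≤-trans (+-monoˡ-≤ _ (⌈n/2⌉≤1+⌊n/2⌋ m)) (s≤s (≤-reflexive (m+[n∸m]≡n (<⇒≤ (m<2l⇒⌊m/2⌋<l m<)))))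
            where
              ⌈n/2⌉≤1+⌊n/2⌋ : ∀ n → ⌈ n /2⌉ ≤ suc ⌊ n /2⌋
              ⌈n/2⌉≤1+⌊n/2⌋ n = ⌊n/2⌋-mono (n≤1+n (suc n))

-- Bit encodings

-- Decoding returns the unread rest, so codes can be concatenated and the padding up to the full
-- memory size is ignored.
record Code (X : Set) : Set₁ where
  field
    Valid : X → Set
    encode : X → List Bool
    decode : List Bool → X × List Bool
    decode-encode : ∀ {x} → Valid x → ∀ rest → decode (encode x ++ rest) ≡ (x , rest)

open Code

bits : ℕ → ℕ → List Bool
bits zero m = []
bits (suc w) m with 2 ^ w ≤? m
... | yes _ = true ∷ bits w (m ∸ 2 ^ w)
... | no _ = false ∷ bits w m

unbits : ℕ → List Bool → ℕ × List Bool
unbits zero bs = 0 , bs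
unbits (suc w) [] = 0 , []
unbits (suc w) (true ∷ bs) = map₁ (2 ^ w +_) (unbits w bs)
unbits (suc w) (false ∷ bs) = unbits w bs

unbits-bits : ∀ w {m} → m < 2 ^ w → ∀ rest → unbits w (bits w m ++ rest) ≡ (m , rest)
unbits-bits zero m<1 rest = cong (_, rest) (sym (n<1⇒n≡0 m<1))
unbits-bits (suc w) {m} m< rest with 2 ^ w ≤? m
... | yes ≤m = trans (cong (map₁ (2 ^ w +_)) (unbits-bits w m∸< rest)) (cong (_, rest) (m+[n∸m]≡n ≤m))
  where
    m∸< : m ∸ 2 ^ w < 2 ^ w
    m∸< = +-cancelˡ-< (2 ^ w) _ _ (subst (_< 2 ^ w + 2 ^ w) (sym (m+[n∸m]≡n ≤m))
      (subst (λ z → m < 2 ^ w + z) (+-identityʳ _) m<))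
... | no ≰m = unbits-bits w (≰⇒> ≰m) rest

length-bits : ∀ w m → length (bits w m) ≡ w
length-bits zero m = refl
length-bits (suc w) m with 2 ^ w ≤? m
... | yes _ = cong suc (length-bits w _)
... | no _ = cong suc (length-bits w m)

natCode : ℕ → Code ℕ
natCode w .Valid m = m < 2 ^ w
natCode w .encode = bits w
natCode w .decode = unbits w
natCode w .decode-encode = unbits-bits w

module _ {X Y : Set} (cˣ : Code X) (cʸ : Code Y) where

  pairCode : Code (X × Y)
  pairCode .Valid (x , y) = Valid cˣ x × Valid cʸ y
  pairCode .encode (x , y) = encode cˣ x ++ encode cʸ y
  pairCode .decode bs with decode cˣ bs
  ... | x , bs′ = map₁ (x ,_) (decode cʸ bs′)
  pairCode .decode-encode {x , y} (vˣ , vʸ) rest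
    rewrite ++-assoc (encode cˣ x) (encode cʸ y) rest
          | decode-encode cˣ vˣ (encode cʸ y ++ rest)
          | decode-encode cʸ vʸ rest = refl

module _ {X : Set} (c : Code X) where

  encodeList : List X → List Bool
  encodeList [] = false ∷ []
  encodeList (x ∷ xs) = true ∷ encode c x ++ encodeList xs

  -- An arbitrary `decode` need not shorten its argument, hence the fuel. The marker bit before each
  -- element makes the length of the code sufficient.
  decodeList : (fuel : ℕ) → List Bool → List X × List Bool
  decodeList zero bs = [] , bs
  decodeList (suc n) [] = [] , []
  decodeList (suc n) (false ∷ bs) = [] , bs
  decodeList (suc n) (true ∷ bs) with decode c bs
  ... | x , bs′ = map₁ (x ∷_) (decodeList n bs′)

  decode-encodeList : ∀ {xs} → All (Valid c) xs → ∀ rest n → length xs < n →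
                      decodeList n (encodeList xs ++ rest) ≡ (xs , rest)
  decode-encodeList [] rest (suc n) _ = refl
  decode-encodeList {x ∷ xs} (v ∷ vs) rest (suc n) (s≤s len<)
    rewrite ++-assoc (encode c x) (encodeList xs) rest
          | decode-encode c v (encodeList xs ++ rest)
          | decode-encodeList vs rest n len< = refl

  length-encodeList : ∀ xs → length (encodeList xs) ≡ suc (sum (map (suc ∘ length ∘ encode c) xs))
  length-encodeList [] = refl
  length-encodeList (x ∷ xs) = cong suc (trans (length-++ (encode c x))
    (trans (cong (length (encode c x) +_) (length-encodeList xs)) (+-suc _ _)))

  length<encodeList : ∀ xs rest → length xs < length (encodeList xs ++ rest)
  length<encodeList [] rest = s≤s z≤n
  length<encodeList (x ∷ xs) rest = s≤s (begin-strict
    length xs                                         <⟨ length<encodeList xs rest ⟩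
    length (encodeList xs ++ rest)                    ≤⟨ m≤n+m _ _ ⟩
    length (encode c x) + length (encodeList xs ++ rest) ≡⟨ sym (length-++ (encode c x)) ⟩
    length (encode c x ++ encodeList xs ++ rest)      ≡⟨ cong length (sym (++-assoc (encode c x) _ rest)) ⟩
    length ((encode c x ++ encodeList xs) ++ rest)    ∎)
    where open ≤-Reasoning

  listCode : Code (List X)
  listCode .Valid = All (Valid c)
  listCode .encode = encodeList
  listCode .decode bs = decodeList (length bs) bs
  listCode .decode-encode {xs} vs rest = decode-encodeList vs rest _ (length<encodeList xs rest)

pad : ∀ s → List Bool → Memory s
pad zero _ = Vec.[]
pad (suc s) [] = false Vec.∷ pad s []
pad (suc s) (b ∷ bs) = b Vec.∷ pad s bs

toList-pad : ∀ s bs → length bs ≤ s → ∃[ rest ] (Vec.toList (pad s bs) ≡ bs ++ rest)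
toList-pad zero [] _ = [] , refl
toList-pad (suc s) [] _ = _ , refl
toList-pad (suc s) (b ∷ bs) (s≤s len≤) with toList-pad s bs len≤
... | rest , eq = rest , cong (b ∷_) eq

-- Machines with structured states, compiled to bit memory

data Step (N K R : ℕ) (X : Set) : Set where
  read   : (Value R → X) → Step N K R X
  write  : Position N K × Value R → X → Step N K R X
  rewind : X → Step N K R X
  halt   : Step N K R X

module Compile {N K R : ℕ} {X : Set} (c : Code X) (s : ℕ) (start : X) (step : X → Step N K R X) where

  opaque

    pack : X → Memory s
    pack x = pad s (encode c x)

    unpack : Memory s → X
    unpack m = proj₁ (decode c (Vec.toList m))

    Fits : X → Set
    Fits x = Valid c x × length (encode c x) ≤ s

    fit : ∀ {x} → Valid c x → length (encode c x) ≤ s → Fits x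
    fit = _,_

    unpack-pack : ∀ {x} → Fits x → unpack (pack x) ≡ x
    unpack-pack {x} (v , len≤) with toList-pad s (encode c x) len≤
    ... | rest , eq rewrite eq | decode-encode c v rest = refl

  action : Step N K R X → Action N K R s
  action (read f) = read (pack ∘ f)
  action (write (i , v) x) = write i v (pack x)
  action (rewind x) = rewind (pack x)
  action halt = halt

  algorithm : Algorithm N K R s
  algorithm .Algorithm.initial = pack start
  algorithm .Algorithm.control m = action (step (unpack m))

  module _ (input : Vec (Value R) N) where

    private
      control-pack : ∀ {x a} → Fits x → step x ≡ a → action (step (unpack (pack x))) ≡ action a
      control-pack fits eq = cong action (trans (cong step (unpack-pack fits)) eq)

    run-halt : ∀ {x xs} → Fits x → step x ≡ halt → Run algorithm input (pack x) xs 0 []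
    run-halt fits eq = halts (control-pack fits eq)

    run-read : ∀ {x f v xs p ws} → Fits x → step x ≡ read f →
      Run algorithm input (pack (f v)) xs p ws → Run algorithm input (pack x) (v ∷ xs) p ws
    run-read fits eq = reads (control-pack fits eq)

    run-write : ∀ {x w x′ xs p ws} → Fits x → step x ≡ write w x′ →
      Run algorithm input (pack x′) xs p ws → Run algorithm input (pack x) xs p (w ∷ ws)
    run-write fits eq = writes (control-pack fits eq)

    run-rewind : ∀ {x x′ xs p ws} → Fits x → step x ≡ rewind x′ →
      Run algorithm input (pack x′) (Vec.toList input) p ws → Run algorithm input (pack x) xs (suc p) ws
    run-rewind fits eq = rewinds (control-pack fits eq)

-- Windows

opaque

  -- The value is n if no m < n satisfies P.
  least : {P : ℕ → Set} → Decidable P → ℕ → ℕ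
  least P? zero = zero
  least P? (suc n) with P? zero
  ... | yes _ = zero
  ... | no _ = suc (least (P? ∘ suc) n)

  least-≤ : ∀ {P : ℕ → Set} (P? : Decidable P) n → least P? n ≤ n
  least-≤ P? zero = z≤n
  least-≤ P? (suc n) with P? zero
  ... | yes _ = z≤n
  ... | no _ = s≤s (least-≤ (P? ∘ suc) n)

  least-sat : ∀ {P : ℕ → Set} (P? : Decidable P) n {m} → m ≤ n → P m → P (least P? n)
  least-sat P? zero z≤n p = p
  least-sat P? (suc n) m≤n p with P? zero
  ... | yes p₀ = p₀
  least-sat P? (suc n) {zero} m≤n p | no ¬p₀ = contradiction p ¬p₀
  least-sat P? (suc n) {suc m} (s≤s m≤n) p | no _ = least-sat (P? ∘ suc) n m≤n p

  least-min : ∀ {P : ℕ → Set} (P? : Decidable P) n {m} → m < least P? n → ¬ P m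
  least-min P? (suc n) m< p with P? zero
  least-min P? (suc n) {zero} m< p | no ¬p₀ = ¬p₀ p
  least-min P? (suc n) {suc m} (s≤s m<) p | no _ = least-min (P? ∘ suc) n m< p

Even : ℕ → Set
Even m = ⌊ m /2⌋ + ⌊ m /2⌋ ≡ m

even? : Decidable Even
even? m = ⌊ m /2⌋ + ⌊ m /2⌋ ≟ m

¬even⇒odd : ∀ m → ¬ Even m → m ≡ suc (⌊ m /2⌋ + ⌊ m /2⌋)
¬even⇒odd zero ¬e = contradiction refl ¬e
¬even⇒odd (suc zero) _ = refl
¬even⇒odd (suc (suc m)) ¬e = cong (suc ∘ suc) (trans
  (¬even⇒odd m λ e → ¬e (trans (cong suc (+-suc _ _)) (cong (suc ∘ suc) e)))
  (sym (+-suc _ _)))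

double-odd⌊⌋ : ∀ c → ⌊ suc (c + c) /2⌋ ≡ c
double-odd⌊⌋ zero = refl
double-odd⌊⌋ (suc c) rewrite +-suc c c = cong suc (double-odd⌊⌋ c)

double⌊⌋ : ∀ c → ⌊ c + c /2⌋ ≡ c
double⌊⌋ zero = refl
double⌊⌋ (suc c) rewrite +-suc c c = cong suc (double⌊⌋ c)

even-double : ∀ c → Even (c + c)
even-double c = cong₂ _+_ (double⌊⌋ c) (double⌊⌋ c)

Chain-odd : ∀ {R l f g c} → Chain R l f g (suc (c + c)) → Dom R (suc c) (l ∸ c) f g
Chain-odd {R} {l} {f} {g} {c} chain =
  subst (λ k → Dom R (suc k) (l ∸ c) f g) (double⌊⌋ c)
    (subst (λ j → Dom R (suc ⌊ c + c /2⌋) (l ∸ j) f g) (double-odd⌊⌋ c) chain)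

Chain-odd⁻¹ : ∀ {R l f g c} → Dom R (suc c) (l ∸ c) f g → Chain R l f g (suc (c + c))
Chain-odd⁻¹ {R} {l} {f} {g} {c} dom =
  subst (λ j → Dom R (suc ⌊ c + c /2⌋) (l ∸ j) f g) (sym (double-odd⌊⌋ c))
    (subst (λ k → Dom R (suc k) (l ∸ c) f g) (sym (double⌊⌋ c)) dom)

Chain-even : ∀ {R l f g c} → Chain R l f g (c + c) → Dom R c (l ∸ c) f g
Chain-even {R} {l} {f} {g} {c} chain =
  subst (λ k → Dom R k (l ∸ c) f g) (double-odd⌊⌋ c)
    (subst (λ j → Dom R ⌈ c + c /2⌉ (l ∸ j) f g) (double⌊⌋ c) chain)

Chain-even⁻¹ : ∀ {R l f g c} → Dom R c (l ∸ c) f g → Chain R l f g (c + c)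
Chain-even⁻¹ {R} {l} {f} {g} {c} dom =
  subst (λ j → Dom R ⌈ c + c /2⌉ (l ∸ j) f g) (sym (double⌊⌋ c))
    (subst (λ k → Dom R k (l ∸ c) f g) (sym (double-odd⌊⌋ c)) dom)

Dom-resp : ∀ {R k k′ j j′ f f′ g g′} → k ≡ k′ → j ≡ j′ → (∀ v → f v ≡ f′ v) → (∀ v → g v ≡ g′ v) →
           Dom R k j f g → Dom R k′ j′ f′ g′
Dom-resp {k = k} {j = j} refl refl f≡ g≡ dom {v} v< j≤ =
  subst (k ≤_) (f≡ v) (dom v< (subst (j ≤_) (sym (g≡ v)) j≤))

consIf : {P : Set} → Dec P → Item → List Item → List Item
consIf (yes _) x xs = x ∷ xs
consIf (no _) x xs = xs

insertIf : {P : Set} → ℕ → Dec P → Item → List Item → List Item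
insertIf l (yes _) x xs = take l (insert x xs)
insertIf l (no _) x xs = xs

module _ {P : ℕ → Set} (P? : Decidable P) (A : ℕ → ℕ) where

  items : ℕ → List Item
  items zero = []
  items (suc t) = consIf (P? t) (t , A t) (items t)

  ct-items : ∀ {Q : Item → Set} (Q? : Decidable Q) t →
             ct Q? (items t) ≡ # (λ p → P? p ×-dec Q? (p , A p)) t
  ct-items Q? zero = refl
  ct-items Q? (suc t) with P? t
  ... | no _ = ct-items Q? t
  ... | yes _ with Q? (t , A t)
  ...   | yes _ = cong suc (ct-items Q? t)
  ...   | no _ = ct-items Q? t

  smallest : ℕ → ℕ → List Item
  smallest l t = take l (isort (items t))

  smallest-suc : ∀ l t → smallest l (suc t) ≡ insertIf l (P? t) (t , A t) (smallest l t)
  smallest-suc l t with P? t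
  ... | yes _ = sym (take-insert l (t , A t) (isort (items t)))
  ... | no _ = refl

Win : ℕ → ℕ → ℕ → Set
Win K i p = i ≤ p × p < i + K

win? : ∀ K i → Decidable (Win K i)
win? K i p = (i ≤? p) ×-dec (p <? i + K)

module Windows (N K R l : ℕ) (1≤l : 1 ≤ l) (l≤K : l ≤ K) (A : ℕ → ℕ) (A≤R : ∀ p → A p ≤ R) where

  pre? : ∀ i t v → Decidable (λ p → Win K i p × Below t v (p , A p))
  pre? i t v p = win? K i p ×-dec below? t v (p , A p)

  post? : ∀ i t v → Decidable (λ p → Win K i p × Above t v (p , A p))
  post? i t v p = win? K i p ×-dec above? t v (p , A p)

  Between : ℕ → ℕ → ℕ → ℕ → Set
  Between s t v p = s ≤ p × p < t × A p ≤ v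

  between? : ∀ s t v → Decidable (Between s t v)
  between? s t v p = (s ≤? p) ×-dec (p <? t) ×-dec (A p ≤? v)

  mid? : ∀ i s t v → Decidable (λ p → Win K i p × Between s t v p)
  mid? i s t v p = win? K i p ×-dec between? s t v p

  whole? : ∀ i v → Decidable (λ p → Win K i p × A p ≤ v)
  whole? i v p = win? K i p ×-dec (A p ≤? v)

  pre post : ℕ → ℕ → ℕ → ℕ
  pre i t v = # (pre? i t v) N
  post i t v = # (post? i t v) N

  mid : ℕ → ℕ → ℕ → ℕ → ℕ
  mid i s t v = # (mid? i s t v) N

  whole : ℕ → ℕ → ℕ
  whole i v = # (whole? i v) N

  -- This is Φ_t(i).
  Lv : ℕ → ℕ → ℕ
  Lv t i = Φ R l (pre i t) (post i t)

  pre-↗ : ∀ i t {v w} → v ≤ w → pre i t v ≤ pre i t w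
  pre-↗ i t v≤w = #-mono (pre? i t _) (pre? i t _) N
    λ _ (win , p<t , a≤v) → win , p<t , ≤-trans a≤v v≤w

  post-↗ : ∀ i t {v w} → v ≤ w → post i t v ≤ post i t w
  post-↗ i t v≤w = #-mono (post? i t _) (post? i t _) N
    λ _ (win , t≤p , a≤v) → win , t≤p , ≤-trans a≤v v≤w

  mid-↗ : ∀ i s t {v w} → v ≤ w → mid i s t v ≤ mid i s t w
  mid-↗ i s t v≤w = #-mono (mid? i s t _) (mid? i s t _) N
    λ _ (win , s≤p , p<t , a≤v) → win , s≤p , p<t , ≤-trans a≤v v≤w

  pre+mid : ∀ i {s t} v → s ≤ t → pre i t v ≡ pre i s v + mid i s t v
  pre+mid i {s} {t} v s≤t = #-partition (pre? i s v) (mid? i s t v) (pre? i t v) N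
    (λ {p} _ (win , p<t , a≤v) →
      [ (λ p<s → inj₁ (win , p<s , a≤v)) , (λ s≤p → inj₂ (win , s≤p , p<t , a≤v)) ]′ (<-≤-connex p s))
    (λ _ (win , p<s , a≤v) → win , <-≤-trans p<s s≤t , a≤v)
    (λ _ (win , _ , p<t , a≤v) → win , p<t , a≤v)
    (λ (_ , p<s , _) (_ , s≤p , _) → <⇒≱ p<s s≤p)

  mid+post : ∀ i {s t} v → s ≤ t → post i s v ≡ mid i s t v + post i t v
  mid+post i {s} {t} v s≤t = #-partition (mid? i s t v) (post? i t v) (post? i s v) N
    (λ {p} _ (win , s≤p , a≤v) →
      [ (λ p<t → inj₁ (win , s≤p , p<t , a≤v)) , (λ t≤p → inj₂ (win , t≤p , a≤v)) ]′ (<-≤-connex p t))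
    (λ _ (win , s≤p , _ , a≤v) → win , s≤p , a≤v)
    (λ _ (win , t≤p , a≤v) → win , ≤-trans s≤t t≤p , a≤v)
    (λ (_ , _ , p<t , _) (_ , t≤p , _) → <⇒≱ p<t t≤p)

  pre+post : ∀ i t v → whole i v ≡ pre i t v + post i t v
  pre+post i t v = #-partition (pre? i t v) (post? i t v) (whole? i v) N
    (λ {p} _ (win , a≤v) →
      [ (λ p<t → inj₁ (win , p<t , a≤v)) , (λ t≤p → inj₂ (win , t≤p , a≤v)) ]′ (<-≤-connex p t))
    (λ _ (win , _ , a≤v) → win , a≤v)
    (λ _ (win , _ , a≤v) → win , a≤v)
    (λ (_ , p<t , _) (_ , t≤p , _) → <⇒≱ p<t t≤p)

  l≤whole : ∀ {i} → i + K ≤ N → l ≤ whole i R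
  l≤whole {i} i+K≤N = begin
    l                       ≤⟨ l≤K ⟩
    K                       ≡⟨ sym (m+n∸m≡n i K) ⟩
    (i + K) ∸ i             ≡⟨ cong (_∸ i) (sym (m≥n⇒m⊓n≡n i+K≤N)) ⟩
    (N ⊓ (i + K)) ∸ i       ≤⟨ #-contains (whole? i R) (λ i≤p p< → (i≤p , p<) , A≤R _) N ⟩
    whole i R               ∎
    where open ≤-Reasoning

  Lv-before : ∀ {t i} → t ≤ i → i + K ≤ N → Lv t i ≡ 1
  Lv-before {t} {i} t≤i i+K≤N = Φ-fempty R l (pre i t) (post i t) 1≤l empty
    (≤-trans (l≤whole i+K≤N) (≤-reflexive (trans (pre+post i t R) (cong (_+ post i t R) (empty R)))))
    where
      empty : ∀ v → pre i t v ≡ 0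
      empty v = #-none (pre? i t v) N λ _ ((i≤p , _) , p<t , _) → <⇒≱ p<t (≤-trans t≤i i≤p)

  Lv-after : ∀ {t i} → N ⊓ (i + K) ≤ t → Lv t i ≡ l + l
  Lv-after {t} {i} ≤t = Φ-gempty R l (pre i t) (post i t) λ v →
    #-none (post? i t v) N λ p<N ((_ , p<i+K) , t≤p , _) → <⇒≱ (⊓-pres-m< p<N p<i+K) (≤-trans ≤t t≤p)

  Lv≤2l : ∀ t i → Lv t i ≤ l + l
  Lv≤2l t i = Φ≤2l R l (pre i t) (post i t)

  1≤Lv : ∀ t i → 1 ≤ Lv t i
  1≤Lv t i = 1≤Φ R l (pre i t) (post i t) 1≤l

  Lv-mono-t : ∀ {s t} i → s ≤ t → Lv s i ≤ Lv t i
  Lv-mono-t {s} {t} i s≤t = Φ-mono R l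
    (λ v → #-mono (pre? i s v) (pre? i t v) N λ _ (win , p<s , a≤v) → win , <-≤-trans p<s s≤t , a≤v)
    (λ v → #-mono (post? i t v) (post? i s v) N λ _ (win , t≤p , a≤v) → win , ≤-trans s≤t t≤p , a≤v)

  -- When t is inside both windows, moving right removes elements before t and adds elements after
  -- t. When t is at or before the start of the right window, or at or past the end of the left one,
  -- the parts need not be nested, but one of the levels has its extreme value 1 or 2l.
  Lv-anti-i : ∀ t {i i′} → i ≤ i′ → i′ + K ≤ N → Lv t i′ ≤ Lv t i
  Lv-anti-i t {i} {i′} i≤i′ i′+K≤N with t ≤? i′ | i + K ≤? t
  ... | yes t≤i′ | _ = ≤-trans (≤-reflexive (Lv-before t≤i′ i′+K≤N)) (1≤Lv t i)
  ... | no _ | yes i+K≤t = ≤-trans (Lv≤2l t i′)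
    (≤-reflexive (sym (Lv-after (≤-trans (m⊓n≤n N (i + K)) i+K≤t))))
  ... | no t≰i′ | no i+K≰t = Φ-mono R l
    (λ v → #-mono (pre? i′ t v) (pre? i t v) N λ _ ((i′≤p , _) , p<t , a≤v) →
      (≤-trans i≤i′ i′≤p , <-trans p<t (≰⇒> i+K≰t)) , p<t , a≤v)
    (λ v → #-mono (post? i t v) (post? i′ t v) N λ _ ((_ , p<i+K) , t≤p , a≤v) →
      (≤-trans (<⇒≤ (≰⇒> t≰i′)) t≤p , <-≤-trans p<i+K (+-monoˡ-≤ K i≤i′)) , t≤p , a≤v)

  -- With d = r - c and e = l - r the two levels supply the hypotheses of `middle-decides`. That c <
  -- r follows from the levels not decreasing in time.
  mid-decides : ∀ {i s t c r} → s ≤ t → Lv s i ≡ suc (c + c) → Lv t i ≡ r + r → ∀ {v} → v ≤ R →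
    (r ∸ c ≤ mid i s t v → l ≤ whole i v) × (l ≤ whole i v → r ∸ c ≤ mid i s t v)
  mid-decides {i} {s} {t} {c} {r} s≤t odd even {v} v≤R =
    (λ d≤ → ≤-trans (≤-reflexive l≡) (≤-trans (proj₁ decides d≤) (≤-reflexive (sym (whole≡ v))))) ,
    (λ l≤ → proj₂ decides (≤-trans (≤-reflexive (sym l≡)) (≤-trans l≤ (≤-reflexive (whole≡ v)))))
    where
      c<r : c < r
      c<r = ≰⇒> λ r≤c → <⇒≱
        (≤-trans (s≤s (≤-reflexive even)) (≤-trans (s≤s (+-mono-≤ r≤c r≤c)) (≤-reflexive (sym odd))))
        (Lv-mono-t i s≤t)

      r≤l : r ≤ l
      r≤l = ≮⇒≥ λ l<r → <⇒≱ (+-mono-< l<r l<r) (≤-trans (≤-reflexive (sym even)) (Lv≤2l t i))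

      l≡ : l ≡ c + (r ∸ c) + (l ∸ r)
      l≡ = sym (trans (cong (_+ (l ∸ r)) (m+[n∸m]≡n (<⇒≤ c<r))) (m+[n∸m]≡n r≤l))

      l∸c≡ : l ∸ c ≡ r ∸ c + (l ∸ r)
      l∸c≡ = trans (cong (_∸ c) (trans l≡ (+-assoc c _ _))) (m+n∸m≡n c _)

      whole≡ : ∀ v → whole i v ≡ pre i s v + mid i s t v + post i t v
      whole≡ v = trans (pre+post i t v) (cong (_+ post i t v) (pre+mid i v s≤t))

      x y z y+z x+y : ℕ → ℕ
      x = pre i s
      y = mid i s t
      z = post i t
      y+z v = y v + z v
      x+y v = x v + y v

      A₁ : Dom R c (r ∸ c + (l ∸ r)) x y+z
      A₁ = Dom-resp {f = x} {g = post i s} refl l∸c≡ (λ _ → refl) (λ v → mid+post i v s≤t)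
        (Chain-even {R} {l} {x} {post i s} {c} (Φ-chain R l x (post i s) (≤-reflexive (sym odd))))

      A₂ : ¬ Dom R (suc c) (r ∸ c + (l ∸ r)) x y+z
      A₂ dom = Φ-¬chain R l x (post i s)
        (≤-trans (s≤s (≤-reflexive (sym (+-suc c c)))) (+-mono-≤ (≤-trans c<r r≤l) (≤-trans c<r r≤l)))
        (≤-reflexive odd)
        (Chain-odd⁻¹ {R} {l} {x} {post i s} {c}
          (Dom-resp {f = x} {g = y+z} refl (sym l∸c≡) (λ _ → refl) (λ v → sym (mid+post i v s≤t)) dom))

      B₁ : Dom R (c + (r ∸ c)) (suc (l ∸ r)) x+y z
      B₁ = at r c<r r≤l even
        where
          at : ∀ r → c < r → r ≤ l → Lv t i ≡ r + r → Dom R (c + (r ∸ c)) (suc (l ∸ r)) x+y z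
          at r@(suc r′) c<r r≤l even =
            Dom-resp {f = pre i t} {g = z} (sym (m+[n∸m]≡n (<⇒≤ c<r))) (+-∸-assoc 1 r≤l)
              (λ v → pre+mid i v s≤t) (λ _ → refl)
              (Chain-odd {R} {l} {pre i t} {z} {r′}
                (Φ-chain R l (pre i t) z (≤-reflexive (sym (trans even (cong suc (+-suc r′ r′)))))))

      -- For r = l the level is the largest possible and there is no further link of the chain that
      -- fails; then e = 0 instead.
      B₂ : l ∸ r ≡ 0 ⊎ ¬ Dom R (c + (r ∸ c)) (l ∸ r) x+y z
      B₂ with m≤n⇒m<n∨m≡n r≤l
      ... | inj₂ refl = inj₁ (n∸n≡0 l)
      ... | inj₁ r<l = inj₂ λ dom → Φ-¬chain R l (pre i t) z (+-mono-< r<l r<l) (≤-reflexive even)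
        (Chain-even⁻¹ {R} {l} {pre i t} {z} {r}
          (Dom-resp {f = x+y} {g = z} (m+[n∸m]≡n (<⇒≤ c<r)) refl
            (λ v → sym (pre+mid i v s≤t)) (λ _ → refl) dom))

      decides = middle-decides R c (r ∸ c) (l ∸ r) (pre i s) (mid i s t) (post i t)
        (pre-↗ i s) (mid-↗ i s t) (post-↗ i t) A₁ A₂ B₁ B₂ {v} (s≤s v≤R)

  summary : ℕ → ℕ → List Item
  summary i = smallest (win? K i) A l

  level-summary : ∀ t i → level R l t (summary i N) ≡ Lv t i
  level-summary t i = trans (level-take l (isort-sorted (items (win? K i) A N)) t R)
    -- The counting functions agree pointwise only; monotonicity of `Φ` in both directions stands in
    -- for function extensionality.
    (≤-antisym
      (Φ-mono R l (λ v → ≤-reflexive (lo≡pre v)) (λ v → ≤-reflexive (sym (hi≡post v))))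
      (Φ-mono R l (λ v → ≤-reflexive (sym (lo≡pre v))) (λ v → ≤-reflexive (hi≡post v))))
    where
      xs = items (win? K i) A N
      lo≡pre : ∀ v → lo t (isort xs) v ≡ pre i t v
      lo≡pre v = trans (ct-↭ (below? t v) (isort-↭ xs)) (ct-items (win? K i) A (below? t v) N)
      hi≡post : ∀ v → hi t (isort xs) v ≡ post i t v
      hi≡post v = trans (ct-↭ (above? t v) (isort-↭ xs)) (ct-items (win? K i) A (above? t v) N)

-- The machine

nth : ∀ {X : Set} → X → List X → ℕ → X
nth d [] j = d
nth d (x ∷ xs) zero = x
nth d (x ∷ xs) (suc j) = nth d xs j

nth-applyUpTo : ∀ {X : Set} (d : X) (f : ℕ → X) n {j} → j < n → nth d (applyUpTo f n) j ≡ f j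
nth-applyUpTo d f (suc n) {zero} _ = refl
nth-applyUpTo d f (suc n) {suc j} (s≤s j<n) = nth-applyUpTo d (f ∘ suc) n j<n

applyUpTo-cong : ∀ {X : Set} {f g : ℕ → X} n → (∀ {j} → j < n → f j ≡ g j) → applyUpTo f n ≡ applyUpTo g n
applyUpTo-cong zero eq = refl
applyUpTo-cong (suc n) eq = cong₂ _∷_ (eq (s≤s z≤n)) (applyUpTo-cong n (eq ∘ s≤s))

clamp : ∀ n → ℕ → Fin (suc n)
clamp n m = fromℕ< (s≤s (m⊓n≤n m n))

Entry : Set
Entry = List Item × List Item

-- (pass, items read, answers written since the last read, summaries, entries)
State : Set
State = ℕ × ℕ × ℕ × List (List Item) × List Entry

module Machine (N K R l b : ℕ) where

  -- The block length is chosen with N < lB², so that n groups of B windows cover all windows.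
  -- Surplus groups have equal ends and are always settled.
  B n : ℕ
  B = suc b
  n = l * B

  -- Group j consists of the windows jB, …, (j+1)B-1; grid j is the first window of group j, cut off at
  -- the last window of all.
  grid : ℕ → ℕ
  grid j = (j * B) ⊓ (N ∸ K)

  lev : ℕ → List Item → ℕ
  lev t e = level R l t e

  settled? : ∀ e e′ t → Dec (lev t e ≡ lev t e′)
  settled? e e′ t = lev t e ≟ lev t e′

  Ready : List Item → List Item → ℕ → Set
  Ready e e′ t = lev t e ≡ lev t e′ × Even (lev t e)

  ready? : ∀ e e′ → Decidable (Ready e e′)
  ready? e e′ t = settled? e e′ t ×-dec even? (lev t e)

  opaque

    time : List Item → List Item → ℕ
    time e e′ = least (ready? e e′) N

    pass : List Item → List Item → ℕ
    pass e e′ = ⌊ lev (time e e′) e /2⌋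

  -- Before the first ready time a group is settled only at odd levels, after which the items read so
  -- far are no longer needed for its answers.
  lastSettled : List Item → List Item → ℕ → ℕ
  lastSettled e e′ zero = zero
  lastSettled e e′ (suc t) with settled? e e′ t
  ... | yes _ = t
  ... | no _ = lastSettled e e′ t

  -- Core j are the positions common to all windows from grid j to grid (suc j), Edge j those in only
  -- some of them.  They are told apart because Core j is too long to be stored.
  Edge Core : ℕ → ℕ → Set
  Edge j p = (grid j ≤ p × p < grid (suc j)) ⊎ (grid (suc j) ≤ p × grid j + K ≤ p × p < grid (suc j) + K)
  Core j p = grid (suc j) ≤ p × p < grid j + K

  edge? : ∀ j → Decidable (Edge j)
  edge? j p = ((grid j ≤? p) ×-dec (p <? grid (suc j)))
    ⊎-dec ((grid (suc j) ≤? p) ×-dec (grid j + K ≤? p) ×-dec (p <? grid (suc j) + K))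

  core? : ∀ j → Decidable (Core j)
  core? j p = (grid (suc j) ≤? p) ×-dec (p <? grid j + K)

  noEntry : Entry
  noEntry = [] , []

  addEntry : ℕ → Item → Entry → Entry
  addEntry j x (raw , com) = consIf (edge? j (proj₁ x)) x raw , insertIf l (core? j (proj₁ x)) x com

  resetIf : {P : Set} → Dec P → Entry → Entry
  resetIf (yes _) d = noEntry
  resetIf (no _) d = d

  addSummaries : Item → List (List Item) → List (List Item)
  addSummaries x E = applyUpTo (λ j → insertIf l (win? K (grid j) (proj₁ x)) x (nth [] E j)) (suc n)

  -- The reset precedes the addition because the item at position t belongs to the part from time t
  -- on.
  addEntries : ℕ → Item → List (List Item) → List Entry → List Entry
  addEntries t x E D =
    applyUpTo (λ j → addEntry j x (resetIf (settled? (nth [] E j) (nth [] E (suc j)) t) (nth noEntry D j))) n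

  inWin? : ∀ i v → Decidable (λ (x : Item) → Win K i (proj₁ x) × proj₂ x ≤ v)
  inWin? i v x = win? K i (proj₁ x) ×-dec (proj₂ x ≤? v)

  count : ℕ → Entry → ℕ → ℕ
  count i (raw , com) v = ct (inWin? i v) raw + ct (atMost? v) com

  -- Halving the odd level 2c+1 at the last settled time gives c. The result is the (r-c)-th
  -- smallest of the elements of window i read since then, found as the least value with enough
  -- elements up to it.
  answer : ℕ → ℕ → List Item → List Item → Entry → ℕ → ℕ
  answer r t e e′ d i = least (λ v → r ∸ ⌊ lev (lastSettled e e′ t) e /2⌋ ≤? count i d v) R

  group : Position N K → ℕ
  group i = toℕ i / B

  Due : ℕ → ℕ → List (List Item) → Position N K → Set
  Due r t E i = time (nth [] E (group i)) (nth [] E (suc (group i))) ≡ t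
              × pass (nth [] E (group i)) (nth [] E (suc (group i))) ≡ r

  due? : ∀ r t E → Decidable (Due r t E)
  due? r t E i = (time (nth [] E (group i)) (nth [] E (suc (group i))) ≟ t)
           ×-dec (pass (nth [] E (group i)) (nth [] E (suc (group i))) ≟ r)

  writeAt : ℕ → ℕ → List (List Item) → List Entry → Position N K → Position N K × Value R
  writeAt r t E D i = i , clamp R (answer r t (nth [] E (group i)) (nth [] E (suc (group i)))
    (nth noEntry D (group i)) (toℕ i))

  writesAt : ℕ → ℕ → List (List Item) → List Entry → List (Position N K × Value R)
  writesAt r t E D = map (writeAt r t E D) (filter (due? r t E) (allFin (suc (N ∸ K))))

  noEntries : List Entry
  noEntries = applyUpTo (λ _ → noEntry) n

  start : State
  start = 0 , 0 , 0 , applyUpTo (λ _ → []) (suc n) , noEntries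

  advance : ℕ → ℕ → List (List Item) → List Entry → Step N K R State
  advance r t E D with t <? N | r <? l
  ... | yes _ | _ = read λ x → r , suc t , 0 , E , addEntries t (t , toℕ x) E D
  ... | no _ | yes _ = rewind (suc r , 0 , 0 , E , noEntries)
  ... | no _ | no _ = halt

  -- The list of due answers is recomputed at each step, and only the number k of those already
  -- written is kept in memory.
  emit : ℕ → ℕ → ℕ → List (List Item) → List Entry → List (Position N K × Value R) → Step N K R State
  emit r t k E D [] = advance r t E D
  emit r t k E D (w ∷ _) = write w (r , t , suc k , E , D)

  step : State → Step N K R State
  step (zero , t , k , E , D) with t <? N
  ... | yes _ = read λ x → 0 , suc t , 0 , addSummaries (t , toℕ x) E , D
  ... | no _ = rewind (1 , 0 , 0 , E , D)
  step (suc r , t , k , E , D) = emit (suc r) t k E D (drop k (writesAt (suc r) t E D))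

-- Contents of the memory, and correctness of the answers

module Semantics (N K R l b : ℕ) (1≤l : 1 ≤ l) (l≤K : l ≤ K) (K≤N : K ≤ N)
                 (A : ℕ → ℕ) (A≤R : ∀ p → A p ≤ R) where

  open Machine N K R l b
  open Windows N K R l 1≤l l≤K A A≤R

  summ : ℕ → List Item
  summ j = summary (grid j) N

  summariesAt : ℕ → List (List Item)
  summariesAt t = applyUpTo (λ j → summary (grid j) t) (suc n)

  summariesAt-suc : ∀ t → summariesAt (suc t) ≡ addSummaries (t , A t) (summariesAt t)
  summariesAt-suc t = applyUpTo-cong (suc n) λ {j} j< →
    trans (smallest-suc (win? K (grid j)) A l t)
      (cong (insertIf l (win? K (grid j) t) (t , A t)) (sym (nth-applyUpTo [] (λ j → summary (grid j) t) (suc n) j<)))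

  summaries : List (List Item)
  summaries = summariesAt N

  nth-summaries : ∀ {j} → j < suc n → nth [] summaries j ≡ summ j
  nth-summaries = nth-applyUpTo [] summ (suc n)

  rawFrom? : ∀ s j → Decidable (λ p → s ≤ p × Edge j p)
  rawFrom? s j p = (s ≤? p) ×-dec edge? j p

  comFrom? : ∀ s j → Decidable (λ p → s ≤ p × Core j p)
  comFrom? s j p = (s ≤? p) ×-dec core? j p

  entryFrom : ℕ → ℕ → ℕ → Entry
  entryFrom s j t = items (rawFrom? s j) A t , smallest (comFrom? s j) A l t

  items-none : ∀ {P : ℕ → Set} (P? : Decidable P) t → (∀ {p} → p < t → ¬ P p) → items P? A t ≡ []
  items-none P? zero none = refl
  items-none P? (suc t) none with P? t
  ... | yes p = contradiction p (none ≤-refl)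
  ... | no _ = items-none P? t (none ∘ m≤n⇒m≤1+n)

  take-[] : ∀ l → take l (isort []) ≡ []
  take-[] zero = refl
  take-[] (suc l) = refl

  entryFrom-self : ∀ s j → entryFrom s j s ≡ noEntry
  entryFrom-self s j = cong₂ _,_
    (items-none (rawFrom? s j) s λ p<s (s≤p , _) → <⇒≱ p<s s≤p)
    (trans (cong (take l ∘ isort) (items-none (comFrom? s j) s λ p<s (s≤p , _) → <⇒≱ p<s s≤p)) (take-[] l))

  entryFrom-suc : ∀ {s t} j → s ≤ t → entryFrom s j (suc t) ≡ addEntry j (t , A t) (entryFrom s j t)
  entryFrom-suc {s} {t} j s≤t = cong₂ _,_ raw
    (trans (smallest-suc (comFrom? s j) A l t) com)
    where
      raw : consIf (rawFrom? s j t) (t , A t) (items (rawFrom? s j) A t)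
          ≡ consIf (edge? j t) (t , A t) (items (rawFrom? s j) A t)
      raw with s ≤? t | edge? j t
      ... | no s≰t | _ = contradiction s≤t s≰t
      ... | yes _ | yes _ = refl
      ... | yes _ | no _ = refl
      com : insertIf l (comFrom? s j t) (t , A t) (smallest (comFrom? s j) A l t)
          ≡ insertIf l (core? j t) (t , A t) (smallest (comFrom? s j) A l t)
      com with s ≤? t | core? j t
      ... | no s≰t | _ = contradiction s≤t s≰t
      ... | yes _ | yes _ = refl
      ... | yes _ | no _ = refl

  last : ℕ → ℕ → ℕ
  last j t = lastSettled (summ j) (summ (suc j)) t

  last-≤ : ∀ j t → last j t ≤ t
  last-≤ j zero = z≤n
  last-≤ j (suc t) with settled? (summ j) (summ (suc j)) t
  ... | yes _ = n≤1+n t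
  ... | no _ = m≤n⇒m≤1+n (last-≤ j t)

  last-< : ∀ j t → last j (suc t) ≤ t
  last-< j t with settled? (summ j) (summ (suc j)) t
  ... | yes _ = ≤-refl
  ... | no _ = last-≤ j t

  entryAt : ℕ → ℕ → Entry
  entryAt t j = entryFrom (last j t) j t

  entryAt-suc : ∀ t j → entryAt (suc t) j ≡
    addEntry j (t , A t) (resetIf (settled? (summ j) (summ (suc j)) t) (entryAt t j))
  entryAt-suc t j with settled? (summ j) (summ (suc j)) t
  ... | yes _ = trans (entryFrom-suc j ≤-refl) (cong (addEntry j (t , A t)) (entryFrom-self t j))
  ... | no _ = entryFrom-suc j (last-≤ j t)

  entriesAt : ℕ → List Entry
  entriesAt t = applyUpTo (entryAt t) n

  nth-entries : ∀ t {j} → j < n → nth noEntry (entriesAt t) j ≡ entryAt t j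
  nth-entries t = nth-applyUpTo noEntry (entryAt t) n

  entriesAt-zero : entriesAt 0 ≡ noEntries
  entriesAt-zero = applyUpTo-cong n λ {j} _ → entryFrom-self 0 j

  entriesAt-suc : ∀ t → entriesAt (suc t) ≡ addEntries t (t , A t) summaries (entriesAt t)
  entriesAt-suc t = applyUpTo-cong n λ {j} j<n → trans (entryAt-suc t j) (cong₂
    (λ (e , e′) d → addEntry j (t , A t) (resetIf (settled? e e′ t) d))
    (cong₂ _,_ (sym (nth-summaries (m≤n⇒m≤1+n j<n))) (sym (nth-summaries (s≤s j<n))))
    (sym (nth-entries t j<n)))

  grid+K≤N : ∀ j → grid j + K ≤ N
  grid+K≤N j = ≤-trans (+-monoˡ-≤ K (m⊓n≤n (j * B) (N ∸ K))) (≤-reflexive (m∸n+n≡m K≤N))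

  grid-mono : ∀ {j j′} → j ≤ j′ → grid j ≤ grid j′
  grid-mono j≤j′ = ⊓-monoˡ-≤ (N ∸ K) (*-monoˡ-≤ B j≤j′)

  lev-summ : ∀ t j → lev t (summ j) ≡ Lv t (grid j)
  lev-summ t j = level-summary t (grid j)

  lev-anti : ∀ t {j j′} → j ≤ j′ → lev t (summ j′) ≤ lev t (summ j)
  lev-anti t {j} {j′} j≤j′ = ≤-trans (≤-reflexive (lev-summ t j′))
    (≤-trans (Lv-anti-i t (grid-mono j≤j′) (grid+K≤N j′)) (≤-reflexive (sym (lev-summ t j))))

  lev-mono : ∀ {s t} j → s ≤ t → lev s (summ j) ≤ lev t (summ j)
  lev-mono {s} {t} j s≤t = ≤-trans (≤-reflexive (lev-summ s j))
    (≤-trans (Lv-mono-t (grid j) s≤t) (≤-reflexive (sym (lev-summ t j))))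

  lev-0 : ∀ j → lev 0 (summ j) ≡ 1
  lev-0 j = trans (lev-summ 0 j) (Lv-before z≤n (grid+K≤N j))

  lev-N : ∀ j → lev N (summ j) ≡ l + l
  lev-N j = trans (lev-summ N j) (Lv-after (m⊓n≤m N _))

  timeOf passOf : ℕ → ℕ
  timeOf j = time (summ j) (summ (suc j))
  passOf j = pass (summ j) (summ (suc j))

  opaque
    unfolding Machine.time

    timeOf≤N : ∀ j → timeOf j ≤ N
    timeOf≤N j = least-≤ (ready? (summ j) (summ (suc j))) N

    -- At time N everything lies before the cut, so both ends have the even level 2l and the search
    -- up to N succeeds.
    timeOf-ready : ∀ j → Ready (summ j) (summ (suc j)) (timeOf j)
    timeOf-ready j = least-sat (ready? (summ j) (summ (suc j))) N ≤-refl
      (trans (lev-N j) (sym (lev-N (suc j))) ,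
       subst Even (sym (lev-N j)) (even-double l))

    lev-time : ∀ j → lev (timeOf j) (summ j) ≡ passOf j + passOf j
    lev-time j = sym (proj₂ (timeOf-ready j))

    timeOf-first : ∀ j {t} → t < timeOf j → ¬ Ready (summ j) (summ (suc j)) t
    timeOf-first j = least-min (ready? (summ j) (summ (suc j))) N

    passOf≤l : ∀ j → passOf j ≤ l
    passOf≤l j = ≤-trans (⌊n/2⌋-mono (≤-trans (≤-reflexive (lev-summ (timeOf j) j)) (Lv≤2l (timeOf j) (grid j))))
      (≤-reflexive (double⌊⌋ l))

  1≤passOf : ∀ j → 1 ≤ passOf j
  1≤passOf j = n≢0⇒n>0 λ pass≡0 → contradiction
    (subst (1 ≤_) (trans (sym (lev-summ (timeOf j) j)) (trans (lev-time j) (cong (λ r → r + r) pass≡0)))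
      (1≤Lv (timeOf j) (grid j))) λ ()

  -- Suppose j′ were ready at t′, before j, with the same r. At t′ both ends of group j have level
  -- at least that of j′, which is 2r, and at most the level of j at its own later ready time, again
  -- 2r. So j was ready at t′ already.
  timeOf-mono : ∀ {j j′} → j ≤ j′ → passOf j ≡ passOf j′ → timeOf j ≤ timeOf j′
  timeOf-mono {j} {j′} j≤j′ pass≡ with m≤n⇒m<n∨m≡n j≤j′
  ... | inj₂ refl = ≤-refl
  ... | inj₁ j<j′ = ≮⇒≥ λ t′<t → timeOf-first j t′<t
    ( trans (eq j ≤-refl (n≤1+n j) (<⇒≤ t′<t)) (sym (eq (suc j) (n≤1+n j) ≤-refl (<⇒≤ t′<t)))
    , subst Even (sym (eq j ≤-refl (n≤1+n j) (<⇒≤ t′<t))) (even-double r))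
    where
      r = passOf j′
      t′ = timeOf j′
      above : ∀ {i} → i ≤ suc j → r + r ≤ lev t′ (summ i)
      above i≤ = ≤-trans (≤-reflexive (sym (lev-time j′))) (lev-anti t′ (≤-trans i≤ j<j′))
      eq : ∀ i → j ≤ i → i ≤ suc j → t′ ≤ timeOf j → lev t′ (summ i) ≡ r + r
      eq i j≤i i≤1+j t′≤t = ≤-antisym
        (≤-trans (lev-anti t′ j≤i) (≤-trans (lev-mono j t′≤t)
          (≤-reflexive (trans (lev-time j) (cong (λ r → r + r) pass≡)))))
        (above i≤1+j)

  -- The default time 0 is settled as well, all levels being 1 before anything is read.
  last-settled : ∀ j t → lev (last j t) (summ j) ≡ lev (last j t) (summ (suc j))
  last-settled j zero = trans (lev-0 j) (sym (lev-0 (suc j)))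
  last-settled j (suc t) with settled? (summ j) (summ (suc j)) t
  ... | yes eq = eq
  ... | no _ = last-settled j t

  -- The level 1 at time 0 is odd, so the ready time is positive. As only times before t are
  -- examined, the entry has not been emptied yet when the answers are computed at t.
  last<timeOf : ∀ j → last j (timeOf j) < timeOf j
  last<timeOf j = go (timeOf j) refl
    where
      go : ∀ t → timeOf j ≡ t → last j t < t
      go zero eq = contradiction
        (subst Even (trans (cong (λ t → lev t (summ j)) eq) (lev-0 j)) (proj₂ (timeOf-ready j))) λ ()
      go (suc t) eq = s≤s (last-< j t)

  module _ (j : ℕ) {i : ℕ} (g≤i : grid j ≤ i) (i≤g : i ≤ grid (suc j)) where

    private
      t = timeOf j
      r = passOf j
      s = last j t
      c = ⌊ lev s (summ j) /2⌋

      i+K≤N : i + K ≤ N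
      i+K≤N = ≤-trans (+-monoˡ-≤ K i≤g) (grid+K≤N (suc j))

      s<t : s < t
      s<t = last<timeOf j

      between : ∀ {u m} → lev u (summ j) ≡ m → lev u (summ j) ≡ lev u (summ (suc j)) → Lv u i ≡ m
      between {u} eq settled = ≤-antisym
        (≤-trans (Lv-anti-i u g≤i i+K≤N) (≤-reflexive (trans (sym (lev-summ u j)) eq)))
        (≤-trans (≤-reflexive (trans (sym eq) (trans settled (lev-summ u (suc j)))))
          (Lv-anti-i u i≤g (grid+K≤N (suc j))))

      odd : Lv s i ≡ suc (c + c)
      odd = between (¬even⇒odd _ λ even → timeOf-first j s<t (last-settled j t , even)) (last-settled j t)

      even : Lv t i ≡ r + r
      even = between (lev-time j) (proj₁ (timeOf-ready j))

      rawWin? : ∀ v → Decidable (λ p → (s ≤ p × Edge j p) × Win K i p × A p ≤ v)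
      rawWin? v p = rawFrom? s j p ×-dec inWin? i v (p , A p)

      comSmall? : ∀ v → Decidable (λ p → (s ≤ p × Core j p) × A p ≤ v)
      comSmall? v p = comFrom? s j p ×-dec atMost? v (p , A p)

      mid-split : ∀ v → mid i s t v ≡ # (rawWin? v) t + # (comSmall? v) t
      mid-split v = trans
        (#-cut (mid? i s t v) (timeOf≤N j) (λ (_ , _ , p<t , _) → p<t))
        (#-partition (rawWin? v) (comSmall? v) (mid? i s t v) t
          split
          (λ p<t ((s≤p , _) , win , a≤v) → win , s≤p , p<t , a≤v)
          (λ p<t ((s≤p , g≤p , p<g) , a≤v) →
            (≤-trans i≤g g≤p , <-≤-trans p<g (+-monoˡ-≤ K g≤i)) , s≤p , p<t , a≤v)
          (λ { ((_ , inj₁ (_ , p<g)) , _) ((_ , g≤p , _) , _) → <⇒≱ p<g g≤p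
             ; ((_ , inj₂ (_ , g+K≤p , _)) , _) ((_ , _ , p<g+K) , _) → <⇒≱ p<g+K g+K≤p }))
        where
          split : ∀ {p} → p < t → Win K i p × Between s t v p →
                  ((s ≤ p × Edge j p) × Win K i p × A p ≤ v) ⊎ ((s ≤ p × Core j p) × A p ≤ v)
          split {p} _ (win@(i≤p , p<i+K) , s≤p , _ , a≤v) with <-≤-connex p (grid (suc j)) | <-≤-connex p (grid j + K)
          ... | inj₁ p<g | _ = inj₁ ((s≤p , inj₁ (≤-trans g≤i i≤p , p<g)) , win , a≤v)
          ... | inj₂ g≤p | inj₁ p<g+K = inj₂ ((s≤p , g≤p , p<g+K) , a≤v)
          ... | inj₂ g≤p | inj₂ g+K≤p =
            inj₁ ((s≤p , inj₂ (g≤p , g+K≤p , <-≤-trans p<i+K (+-monoˡ-≤ K i≤g))) , win , a≤v)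

      module _ (v : ℕ) where
        com = items (comFrom? s j) A t

        raw≡ : ct (inWin? i v) (items (rawFrom? s j) A t) ≡ # (rawWin? v) t
        raw≡ = ct-items (rawFrom? s j) A (inWin? i v) t

        com≡ : ct (atMost? v) (isort com) ≡ # (comSmall? v) t
        com≡ = trans (ct-↭ (atMost? v) (isort-↭ com)) (ct-items (comFrom? s j) A (atMost? v) t)

        untruncated : ct (inWin? i v) (items (rawFrom? s j) A t) + ct (atMost? v) (isort com) ≡ mid i s t v
        untruncated = trans (cong₂ _+_ raw≡ com≡) (sym (mid-split v))

        count⇒mid : r ∸ c ≤ count i (entryAt t j) v → r ∸ c ≤ mid i s t v
        count⇒mid le = ≤-trans le (≤-trans (+-monoʳ-≤ _ (≤-trans (m≤m+n _ _)
          (≤-reflexive (sym (ct-take-drop (atMost? v) l (isort com)))))) (≤-reflexive untruncated))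

        -- The threshold r - c is at most l, so cutting the core items down to l cannot hide that it
        -- is reached.
        mid⇒count : r ∸ c ≤ mid i s t v → r ∸ c ≤ count i (entryAt t j) v
        mid⇒count le = take-atMost l (isort-sorted com)
          {a = ct (inWin? i v) (items (rawFrom? s j) A t)} (≤-trans (m∸n≤m r c) (passOf≤l j))
          (≤-trans le (≤-reflexive (sym untruncated)))

        decides : v ≤ R → (r ∸ c ≤ mid i s t v → l ≤ whole i v) × (l ≤ whole i v → r ∸ c ≤ mid i s t v)
        decides = mid-decides {c = c} {r = r} (<⇒≤ s<t) odd even

      found? : Decidable (λ v → r ∸ c ≤ count i (entryAt t j) v)
      found? v = r ∸ c ≤? count i (entryAt t j) v

    answerOf : ℕ
    answerOf = answer r t (summ j) (summ (suc j)) (entryAt t j) i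

    answerOf-≤ : answerOf ≤ R
    answerOf-≤ = least-≤ found? R

    answerOf-enough : l ≤ whole i answerOf
    answerOf-enough = proj₁ (decides answerOf answerOf-≤) (count⇒mid answerOf
      (least-sat found? R ≤-refl (mid⇒count R (proj₂ (decides R ≤-refl) (l≤whole i+K≤N)))))

    answerOf-least : ∀ {v} → v < answerOf → whole i v < l
    answerOf-least {v} v< = ≰⇒> λ l≤ → least-min found? R v<
      (mid⇒count v (proj₂ (decides v (≤-trans (<⇒≤ v<) answerOf-≤)) l≤))

-- Space

n≤2^⌈log₂n⌉ : ∀ n → n ≤ 2 ^ ⌈log₂ n ⌉
n≤2^⌈log₂n⌉ = <-rec _ go
  where
    open ≤-Reasoning
    go : ∀ n → (∀ {k} → k < n → k ≤ 2 ^ ⌈log₂ k ⌉) → n ≤ 2 ^ ⌈log₂ n ⌉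
    go zero rec = z≤n
    go (suc zero) rec = ≤-refl
    go n@(suc (suc m)) rec = begin
      n                              ≡⟨ sym (⌊n/2⌋+⌈n/2⌉≡n n) ⟩
      ⌊ n /2⌋ + ⌈ n /2⌉              ≤⟨ +-mono-≤ (≤-trans (⌊n/2⌋≤⌈n/2⌉ n) half) half ⟩
      2 ^ k + 2 ^ k                  ≡⟨ cong (2 ^ k +_) (sym (+-identityʳ _)) ⟩
      2 ^ suc k                      ≡⟨ cong (2 ^_) (m+[n∸m]≡n {1} (⌈log₂⌉-mono-≤ {2} {n} (s≤s (s≤s z≤n)))) ⟩
      2 ^ ⌈log₂ n ⌉                  ∎
      where
        k = ⌈log₂ n ⌉ ∸ 1
        half : ⌈ n /2⌉ ≤ 2 ^ k
        half = subst (λ k → ⌈ n /2⌉ ≤ 2 ^ k) (⌈log₂⌈n/2⌉⌉≡⌈log₂n⌉∸1 n) (rec (⌈n/2⌉<n m))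

sum-bounded : ∀ (f : ℕ → ℕ) {c} n → (∀ j → f j ≤ c) → sum (applyUpTo f n) ≤ n * c
sum-bounded f zero f≤ = z≤n
sum-bounded f (suc n) f≤ = +-mono-≤ (f≤ 0) (sum-bounded (f ∘ suc) n (f≤ ∘ suc))

-- A telescoping sum: c is charged to each unit by which L drops, and all drops together are at most
-- L 0.
sum-drops : ∀ (f L : ℕ → ℕ) {a c} n → (∀ j → f j + L (suc j) * c ≤ a + L j * c) →
            sum (applyUpTo f n) ≤ n * a + L 0 * c
sum-drops f L zero f≤ = z≤n
sum-drops f L {a} {c} (suc n) f≤ = begin
  f 0 + sum (applyUpTo (f ∘ suc) n) ≤⟨ +-monoʳ-≤ (f 0) (sum-drops (f ∘ suc) (L ∘ suc) n (f≤ ∘ suc)) ⟩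
  f 0 + (n * a + L 1 * c)           ≡⟨ solve 3 (λ x y z → x :+ (y :+ z) := (x :+ z) :+ y) refl (f 0) (n * a) (L 1 * c) ⟩
  f 0 + L 1 * c + n * a             ≤⟨ +-monoˡ-≤ (n * a) (f≤ 0) ⟩
  a + L 0 * c + n * a               ≡⟨ solve 3 (λ x y z → (x :+ y) :+ z := (x :+ z) :+ y) refl a (L 0 * c) (n * a) ⟩
  a + n * a + L 0 * c               ∎
  where
    open ≤-Reasoning
    open +-*-Solver

length-items : ∀ {P : ℕ → Set} (P? : Decidable P) A t → length (items P? A t) ≡ # P? t
length-items P? A zero = refl
length-items P? A (suc t) with P? t
... | yes _ = cong suc (length-items P? A t)
... | no _ = length-items P? A t

module Memory (N K R l b : ℕ) where

  open Machine N K R l b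

  w : ℕ
  w = logTerm N R

  itemCode : Code Item
  itemCode = pairCode (natCode w) (natCode w)

  entryCode : Code Entry
  entryCode = pairCode (listCode itemCode) (listCode itemCode)

  stateCode : Code State
  stateCode = pairCode (natCode w) (pairCode (natCode w) (pairCode (natCode w)
    (pairCode (listCode (listCode itemCode)) (listCode entryCode))))

  -- With n = lB this is 42wl²B, the order of l items of O(w) bits for each of n grid windows. The
  -- factor 42 is the sum of the coefficients in `total≤space`: 12 from counters and markers and 30
  -- from items.
  space : ℕ
  space = 42 * (w * (l * n))

module Size (N K R l b : ℕ) (1≤l : 1 ≤ l) (l≤K : l ≤ K) (K≤N : K ≤ N)
            (A : ℕ → ℕ) (A≤R : ∀ p → A p ≤ R) where

  open Machine N K R l b
  open Windows N K R l 1≤l l≤K A A≤R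
  open Semantics N K R l b 1≤l l≤K K≤N A A≤R
  open Memory N K R l b
  open Code

  1≤w : 1 ≤ w
  1≤w = ≤-trans (⌈log₂⌉-mono-≤ {2} {suc N} (s≤s (≤-trans 1≤l (≤-trans l≤K K≤N)))) (m≤m+n _ _)

  fitsN : ∀ {m} → m ≤ N → m < 2 ^ w
  fitsN {m} m≤N = ≤-trans (s≤s m≤N) (≤-trans (n≤2^⌈log₂n⌉ (suc N)) (^-monoʳ-≤ 2 (m≤m+n ⌈log₂ suc N ⌉ ⌈log₂ suc R ⌉)))

  fitsR : ∀ {m} → m ≤ R → m < 2 ^ w
  fitsR {m} m≤R = ≤-trans (s≤s m≤R) (≤-trans (n≤2^⌈log₂n⌉ (suc R)) (^-monoʳ-≤ 2 (m≤n+m ⌈log₂ suc R ⌉ ⌈log₂ suc N ⌉)))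

  items-valid : ∀ {P : ℕ → Set} (P? : Decidable P) {t} → t ≤ N → All (Valid itemCode) (items P? A t)
  items-valid P? {zero} t≤N = []
  items-valid P? {suc t} t≤N with P? t
  ... | yes _ = (fitsN (<⇒≤ t≤N) , fitsR (A≤R t)) ∷ items-valid P? (<⇒≤ t≤N)
  ... | no _ = items-valid P? (<⇒≤ t≤N)

  smallest-valid : ∀ {P : ℕ → Set} (P? : Decidable P) {t} → t ≤ N → All (Valid itemCode) (smallest P? A l t)
  smallest-valid P? {t} t≤N = Allₚ.take⁺ l (All-resp-↭ (↭-sym (isort-↭ (items P? A t))) (items-valid P? t≤N))

  summaries-valid : ∀ {t} → t ≤ N → All (Valid (listCode itemCode)) (summariesAt t)
  summaries-valid t≤N = Allₚ.applyUpTo⁺₂ _ (suc n) λ j → smallest-valid (win? K (grid j)) t≤N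

  entries-valid : ∀ {t} → t ≤ N → All (Valid entryCode) (entriesAt t)
  entries-valid {t} t≤N = Allₚ.applyUpTo⁺₂ _ n λ j →
    items-valid (rawFrom? (last j t) j) t≤N , smallest-valid (comFrom? (last j t) j) t≤N

  q : ℕ
  q = suc (w + w)

  length-item : ∀ x → length (encode itemCode x) ≡ w + w
  length-item (p , a) = trans (length-++ (bits w p)) (cong₂ _+_ (length-bits w p) (length-bits w a))

  length-itemList : ∀ xs → length (encodeList itemCode xs) ≡ suc (length xs * q)
  length-itemList xs = trans (length-encodeList itemCode xs) (cong suc (go xs))
    where
      go : ∀ xs → sum (map (suc ∘ length ∘ encode itemCode) xs) ≡ length xs * q
      go [] = refl
      go (x ∷ xs) = cong₂ _+_ (cong suc (length-item x)) (go xs)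

  size : Entry → ℕ
  size (raw , com) = length raw + length com

  length-entry : ∀ d → length (encode entryCode d) ≡ 2 + size d * q
  length-entry (raw , com) = begin
    length (encodeList itemCode raw ++ encodeList itemCode com)
      ≡⟨ length-++ (encodeList itemCode raw) ⟩
    length (encodeList itemCode raw) + length (encodeList itemCode com)
      ≡⟨ cong₂ _+_ (length-itemList raw) (length-itemList com) ⟩
    suc (length raw * q) + suc (length com * q)
      ≡⟨ solve 3 (λ x y z → (con 1 :+ x :* z) :+ (con 1 :+ y :* z) := con 2 :+ (x :+ y) :* z) refl
           (length raw) (length com) q ⟩
    2 + size (raw , com) * q ∎
    where
      open ≡-Reasoning
      open +-*-Solver

  grid-step : ∀ j → grid (suc j) ≤ B + grid j
  grid-step j = begin
    (B + j * B) ⊓ (N ∸ K)         ≤⟨ ⊓-monoʳ-≤ (B + j * B) (m≤n+m (N ∸ K) B) ⟩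
    (B + j * B) ⊓ (B + (N ∸ K))   ≡⟨ sym (+-distribˡ-⊓ B (j * B) (N ∸ K)) ⟩
    B + grid j                    ∎
    where open ≤-Reasoning

  -- Neighbouring grid points are at most B apart, so each of the two ends of the windows
  -- contributes at most B edge positions; the core is cut down to l.
  entryFrom-size : ∀ s j t → size (entryFrom s j t) ≤ B + B + l
  entryFrom-size s j t = +-mono-≤ raw≤ (≤-trans (≤-reflexive (length-take l (isort (items (comFrom? s j) A t)))) (m⊓n≤m l _))
    where
      left? : Decidable (λ p → grid j ≤ p × p < grid (suc j))
      left? p = (grid j ≤? p) ×-dec (p <? grid (suc j))
      right? : Decidable (λ p → (grid j + K ≤ p × p < grid (suc j) + K) × ¬ (p < grid (suc j)))
      right? p = ((grid j + K ≤? p) ×-dec (p <? grid (suc j) + K)) ×-dec ¬? (p <? grid (suc j))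
      both? : Decidable (λ p → (grid j ≤ p × p < grid (suc j)) ⊎
                ((grid j + K ≤ p × p < grid (suc j) + K) × ¬ (p < grid (suc j))))
      both? p = left? p ⊎-dec right? p
      raw≤ : length (items (rawFrom? s j) A t) ≤ B + B
      raw≤ = begin
        length (items (rawFrom? s j) A t) ≡⟨ length-items (rawFrom? s j) A t ⟩
        # (rawFrom? s j) t                ≤⟨ #-mono (rawFrom? s j) both? t (λ _ → λ
          { (_ , inj₁ left) → inj₁ left
          ; (_ , inj₂ (g≤p , right)) → inj₂ (right , ≤⇒≯ g≤p) }) ⟩
        # both? t                         ≡⟨ #-partition left? right? both? t (λ _ z → z) (λ _ → inj₁) (λ _ → inj₂)
                                               (λ (_ , p<g) (_ , p≮g) → p≮g p<g) ⟩
        # left? t + # right? t            ≤⟨ +-mono-≤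
          (≤-trans (#-within left? (λ z → z) t) (≤-trans (∸-monoˡ-≤ (grid j) (m⊓n≤n t _)) left≤))
          (≤-trans (#-within right? proj₁ t) (≤-trans (∸-monoˡ-≤ (grid j + K) (m⊓n≤n t _)) right≤)) ⟩
        B + B                             ∎
        where
          open ≤-Reasoning
          left≤ : grid (suc j) ∸ grid j ≤ B
          left≤ = m≤n+o⇒m∸n≤o _ (grid j) (≤-trans (grid-step j) (≤-reflexive (+-comm B (grid j))))
          right≤ : (grid (suc j) + K) ∸ (grid j + K) ≤ B
          right≤ = ≤-trans (≤-reflexive (trans (cong₂ _∸_ (+-comm (grid (suc j)) K) (+-comm (grid j) K))
            ([m+n]∸[m+o]≡n∸o K (grid (suc j)) (grid j)))) left≤

  consIf-length : ∀ {P : Set} (P? : Dec P) x xs → length (consIf P? x xs) ≤ suc (length xs)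
  consIf-length (yes _) x xs = ≤-refl
  consIf-length (no _) x xs = n≤1+n _

  insertIf-length : ∀ {P : Set} (P? : Dec P) x xs → length (insertIf l P? x xs) ≤ suc (length xs)
  insertIf-length (yes _) x xs = ≤-trans (≤-reflexive (length-take l _))
    (≤-trans (m⊓n≤n l _) (≤-reflexive (↭-length (insert-↭ x xs))))
  insertIf-length (no _) x xs = n≤1+n _

  addEntry-size : ∀ j x d → size (addEntry j x d) ≤ 2 + size d
  addEntry-size j x (raw , com) = ≤-trans
    (+-mono-≤ (consIf-length (edge? j (proj₁ x)) x raw) (insertIf-length (core? j (proj₁ x)) x com))
    (≤-reflexive (cong suc (+-suc _ _)))

  V : ℕ
  V = B + B + l

  -- A settled group was just emptied and holds at most the new item, with 2 as a crude bound. An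
  -- unsettled one may hold V items more, paid for by the drop of the level by at least 1 from its
  -- left end to its right end.
  entryAt-size : ∀ t j → size (entryAt (suc t) j) + lev t (summ (suc j)) * V ≤ 2 + lev t (summ j) * V
  entryAt-size t j = ≤-trans
    (+-monoˡ-≤ (L′ * V) (≤-trans (≤-reflexive (cong size (entryAt-suc t j))) (addEntry-size j (t , A t) _)))
    (reset-size (settled? (summ j) (summ (suc j)) t))
    where
      L L′ : ℕ
      L = lev t (summ j)
      L′ = lev t (summ (suc j))
      reset-size : (eq? : Dec (L ≡ L′)) → 2 + size (resetIf eq? (entryAt t j)) + L′ * V ≤ 2 + L * V
      reset-size (yes L≡L′) = +-monoʳ-≤ 2 (*-monoˡ-≤ V (≤-reflexive (sym L≡L′)))
      reset-size (no L≢L′) = +-monoʳ-≤ 2 (≤-trans (+-monoˡ-≤ (L′ * V) (entryFrom-size (last j t) j t))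
        (*-monoˡ-≤ V (≤∧≢⇒< (lev-anti t (n≤1+n j)) (L≢L′ ∘ sym))))

  entries-size : ∀ t → sum (applyUpTo (size ∘ entryAt t) n) ≤ n * 2 + (l + l) * V
  entries-size zero = ≤-trans (sum-bounded (size ∘ entryAt 0) n
    (λ j → ≤-trans (≤-reflexive (cong size (entryFrom-self 0 j))) (z≤n {2}))) (m≤m+n _ _)
  entries-size (suc t) = ≤-trans (sum-drops (size ∘ entryAt (suc t)) (λ j → lev t (summ j)) n (entryAt-size t))
    (+-monoʳ-≤ (n * 2) (*-monoˡ-≤ V (≤-trans (≤-reflexive (lev-summ t 0)) (Lv≤2l t (grid 0)))))

  length-summaries : ∀ t → length (encode (listCode (listCode itemCode)) (summariesAt t)) ≤ suc (suc n * (2 + l * q))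
  length-summaries t = ≤-trans (≤-reflexive (trans (length-encodeList (listCode itemCode) (summariesAt t))
      (cong (suc ∘ sum) (map-applyUpTo (λ j → summary (grid j) t) (suc ∘ length ∘ encodeList itemCode) (suc n)))))
    (s≤s (sum-bounded _ (suc n) λ j → ≤-trans (s≤s (≤-reflexive (length-itemList (summary (grid j) t))))
      (+-monoʳ-≤ 2 (*-monoˡ-≤ q (≤-trans (≤-reflexive (length-take l _)) (m⊓n≤m l _))))))

  length-entries : ∀ t → length (encode (listCode entryCode) (entriesAt t)) ≤
                   suc (n * 3 + (n * 2 + (l + l) * V) * q)
  length-entries t = ≤-trans (≤-reflexive (trans (length-encodeList entryCode (entriesAt t))
      (cong (suc ∘ sum) (map-applyUpTo (entryAt t) (suc ∘ length ∘ encode entryCode) n))))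
    (s≤s (≤-trans (≤-reflexive (go (entryAt t) n)) (+-monoʳ-≤ (n * 3) (*-monoˡ-≤ q (entries-size t)))))
    where
      open +-*-Solver
      go : ∀ (f : ℕ → Entry) n → sum (applyUpTo (suc ∘ length ∘ encode entryCode ∘ f) n) ≡
                                 n * 3 + sum (applyUpTo (size ∘ f) n) * q
      go f zero = refl
      go f (suc n) = trans (cong₂ _+_ (cong suc (length-entry (f 0))) (go (f ∘ suc) n))
        (solve 4 (λ x n y q → (con 3 :+ x :* q) :+ (n :* con 3 :+ y :* q) :=
                              (con 3 :+ n :* con 3) :+ (x :+ y) :* q) refl
          (size (f 0)) n (sum (applyUpTo (size ∘ f ∘ suc) n)) q)

  total≤space : w + (w + (w + (suc (suc n * (2 + l * q)) + suc (n * 3 + (n * 2 + (l + l) * V) * q)))) ≤ space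
  total≤space = begin
    w + (w + (w + (suc (suc n * (2 + l * q)) + suc (n * 3 + (n * 2 + (l + l) * V) * q))))
      ≡⟨ solve 4 (λ w n l b →
           let B = con 1 :+ b
               q = con 1 :+ (w :+ w)
           in w :+ (w :+ (w :+ ((con 1 :+ (con 1 :+ n) :* (con 2 :+ l :* q)) :+
              (con 1 :+ (n :* con 3 :+ (n :* con 2 :+ (l :+ l) :* (B :+ B :+ l)) :* q)))))
              := con 3 :* w :+ con 2 :+ (con 1 :+ n) :* con 2 :+ n :* con 3 :+
                 q :* ((con 1 :+ n) :* l :+ n :* con 2 :+ con 4 :* (l :* B) :+ con 2 :* (l :* l)))
           refl w n l b ⟩
    3 * w + 2 + suc n * 2 + n * 3 + q * (suc n * l + n * 2 + 4 * n + 2 * (l * l))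
      ≤⟨ +-mono-≤ small (*-mono-≤ q≤3w large) ⟩
    3 * W + 2 * W + (W + W) * 2 + W * 3 + (3 * w) * ((M + M) + M * 2 + 4 * M + 2 * M)
      ≡⟨ solve 2 (λ w M → let W = w :* M in
           con 3 :* W :+ con 2 :* W :+ (W :+ W) :* con 2 :+ W :* con 3 :+
             (con 3 :* w) :* ((M :+ M) :+ M :* con 2 :+ con 4 :* M :+ con 2 :* M)
             := con 42 :* W) refl w M ⟩
    space ∎
    where
      open ≤-Reasoning
      open +-*-Solver
      M = l * n
      W = w * M
      1≤n : 1 ≤ n
      1≤n = *-mono-≤ 1≤l (s≤s z≤n)
      1≤M : 1 ≤ M
      1≤M = *-mono-≤ 1≤l 1≤n
      n≤M : n ≤ M
      n≤M = ≤-trans (≤-reflexive (sym (*-identityˡ n))) (*-monoˡ-≤ n 1≤l)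
      l≤M : l ≤ M
      l≤M = ≤-trans (≤-reflexive (sym (*-identityʳ l))) (*-monoʳ-≤ l 1≤n)
      M≤W : M ≤ W
      M≤W = ≤-trans (≤-reflexive (sym (*-identityˡ M))) (*-monoˡ-≤ M 1≤w)
      w≤W : w ≤ W
      w≤W = ≤-trans (≤-reflexive (sym (*-identityʳ w))) (*-monoʳ-≤ w 1≤M)
      n≤W : n ≤ W
      n≤W = ≤-trans n≤M M≤W
      1≤W : 1 ≤ W
      1≤W = ≤-trans 1≤M M≤W
      small : 3 * w + 2 + suc n * 2 + n * 3 ≤ 3 * W + 2 * W + (W + W) * 2 + W * 3
      small = +-mono-≤ (+-mono-≤ (+-mono-≤ (*-monoʳ-≤ 3 w≤W) (*-monoʳ-≤ 2 1≤W))
        (*-monoˡ-≤ 2 (+-mono-≤ 1≤W n≤W))) (*-monoˡ-≤ 3 n≤W)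
      large : suc n * l + n * 2 + 4 * n + 2 * (l * l) ≤ (M + M) + M * 2 + 4 * M + 2 * M
      large = +-mono-≤ (+-mono-≤ (+-mono-≤ (+-mono-≤ l≤M (≤-reflexive (*-comm n l))) (*-monoˡ-≤ 2 n≤M))
        (*-monoʳ-≤ 4 n≤M)) (*-monoʳ-≤ 2 (*-monoʳ-≤ l
          (≤-trans (≤-reflexive (sym (*-identityʳ l))) (*-monoʳ-≤ l (s≤s z≤n)))))
      q≤3w : q ≤ 3 * w
      q≤3w = ≤-trans (+-monoˡ-≤ (w + w) 1≤w) (≤-reflexive (cong (λ z → w + (w + z)) (sym (+-identityʳ w))))

  length-state : ∀ r t k u v → length (encode stateCode (r , t , k , summariesAt u , entriesAt v)) ≤ space
  length-state r t k u v = ≤-trans (≤-reflexive (trans (length-++ (bits w r)) (cong₂ _+_ (length-bits w r)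
    (trans (length-++ (bits w t)) (cong₂ _+_ (length-bits w t)
    (trans (length-++ (bits w k)) (cong₂ _+_ (length-bits w k)
      (length-++ (encode (listCode (listCode itemCode)) (summariesAt u))))))))))
    (≤-trans (+-monoʳ-≤ w (+-monoʳ-≤ w (+-monoʳ-≤ w (+-mono-≤ (length-summaries u) (length-entries v))))) total≤space)

-- Execution

-- Positions past the end hold 0.
valueAt : ∀ {R} → List (Value R) → ℕ → ℕ
valueAt [] p = 0
valueAt (x ∷ xs) zero = toℕ x
valueAt (x ∷ xs) (suc p) = valueAt xs p

valueAt≤R : ∀ {R} (xs : List (Value R)) p → valueAt xs p ≤ R
valueAt≤R [] p = z≤n
valueAt≤R (x ∷ xs) zero = s≤s⁻¹ (toℕ<n x)
valueAt≤R (x ∷ xs) (suc p) = valueAt≤R xs p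

drop-valueAt : ∀ {R} (xs : List (Value R)) {p} → p < length xs →
               ∃[ x ] (drop p xs ≡ x ∷ drop (suc p) xs × toℕ x ≡ valueAt xs p)
drop-valueAt (x ∷ xs) {zero} _ = x , refl , refl
drop-valueAt (x ∷ xs) {suc p} (s≤s p<) = drop-valueAt xs p<

drop-∷ : ∀ {X : Set} k (xs : List X) {y ys} → drop k xs ≡ y ∷ ys → k < length xs × drop (suc k) xs ≡ ys
drop-∷ zero (x ∷ xs) refl = s≤s z≤n , refl
drop-∷ (suc k) (x ∷ xs) eq with drop-∷ k xs eq
... | k< , eq′ = s≤s k< , eq′

module Execution (N K R l b : ℕ) (1≤l : 1 ≤ l) (l≤K : l ≤ K) (K≤N : K ≤ N) (input : Vec (Value R) N) where

  xs : List (Value R)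
  xs = Vec.toList input

  A : ℕ → ℕ
  A = valueAt xs

  open Machine N K R l b
  open Semantics N K R l b 1≤l l≤K K≤N A (valueAt≤R xs)
  open Memory N K R l b
  open Size N K R l b 1≤l l≤K K≤N A (valueAt≤R xs)
  open Compile {N} {K} {R} stateCode space start step

  W : ℕ → ℕ → List (Position N K × Value R)
  W r t = writesAt r t summaries (entriesAt t)

  -- The last argument is the number of items still to be read. There are N + 1 times, since answers
  -- may also be due after the last item.
  passWrites : ℕ → ℕ → ℕ → List (Position N K × Value R)
  passWrites r t zero = W r t
  passWrites r t (suc e) = W r t ++ passWrites r (suc t) e

  passesFrom : ℕ → ℕ → List (Position N K × Value R)
  passesFrom r zero = []
  passesFrom r (suc d) = passWrites r 0 N ++ passesFrom (suc r) d

  private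
    Runs : State → List (Value R) → ℕ → List (Position N K × Value R) → Set
    Runs st = Run algorithm input (pack st)

  l≤N : l ≤ N
  l≤N = ≤-trans l≤K K≤N

  -- Two separate times u and v are needed: the first pass changes the summaries while the entries
  -- are empty, and the later passes change the entries while the summaries are complete.
  fits : ∀ {r t k u v} → r ≤ N → t ≤ N → k ≤ N → u ≤ N → v ≤ N →
         Fits (r , t , k , summariesAt u , entriesAt v)
  fits {r} {t} {k} {u} {v} r≤ t≤ k≤ u≤ v≤ =
    fit {r , t , k , summariesAt u , entriesAt v} (fitsN r≤ , fitsN t≤ , fitsN k≤ , summaries-valid u≤ , entries-valid v≤) (length-state r t k u v)

  length-W : ∀ r t → length (W r t) ≤ N
  length-W r t = begin
    length (W r t)               ≡⟨ length-map _ (filter (due? r t summaries) (allFin (suc (N ∸ K)))) ⟩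
    length (filter (due? r t summaries) (allFin (suc (N ∸ K))))
                                 ≤⟨ length-filter (due? r t summaries) (allFin (suc (N ∸ K))) ⟩
    length (allFin (suc (N ∸ K))) ≡⟨ length-tabulate id ⟩
    suc (N ∸ K)                  ≤⟨ +-monoˡ-≤ (N ∸ K) (≤-trans 1≤l l≤K) ⟩
    K + (N ∸ K)                  ≡⟨ m+[n∸m]≡n K≤N ⟩
    N                            ∎
    where open ≤-Reasoning

  advance-read : ∀ {r t E D} → t < N →
    advance r t E D ≡ read (λ x → r , suc t , 0 , E , addEntries t (t , toℕ x) E D)
  advance-read {r} {t} t<N with t <? N | r <? l
  ... | yes _ | _ = refl
  ... | no t≮N | _ = contradiction t<N t≮N

  advance-rewind : ∀ {r t E D} → N ≤ t → r < l → advance r t E D ≡ rewind (suc r , 0 , 0 , E , noEntries)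
  advance-rewind {r} {t} N≤t r<l with t <? N | r <? l
  ... | yes t<N | _ = contradiction N≤t (<⇒≱ t<N)
  ... | no _ | yes _ = refl
  ... | no _ | no r≮l = contradiction r<l r≮l

  advance-halt : ∀ {r t E D} → N ≤ t → l ≤ r → advance r t E D ≡ halt
  advance-halt {r} {t} N≤t l≤r with t <? N | r <? l
  ... | yes t<N | _ = contradiction N≤t (<⇒≱ t<N)
  ... | no _ | yes r<l = contradiction l≤r (<⇒≱ r<l)
  ... | no _ | no _ = refl

  stateAt : ℕ → ℕ → ℕ → State
  stateAt r t k = r , t , k , summaries , entriesAt t

  stateAt-fits : ∀ {r t k} → r ≤ N → t ≤ N → k ≤ N → Fits (stateAt r t k)
  stateAt-fits {r} {t} {k} r≤ t≤ k≤ = fits {r} {t} {k} {N} {t} r≤ t≤ k≤ ≤-refl t≤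

  step-stateAt : ∀ r t k {ws} → drop k (W (suc r) t) ≡ ws →
                 step (stateAt (suc r) t k) ≡ emit (suc r) t k summaries (entriesAt t) ws
  step-stateAt r t k = cong (emit (suc r) t k summaries (entriesAt t))

  -- Written with a continuation: `next` is the run after the due answers are exhausted, for
  -- whatever count k is then stored, so that reading on, rewinding and halting share this lemma.
  run-writes : ∀ {r t xs p ws} → suc r ≤ N → t ≤ N →
    (∀ {k} → k ≤ N → drop k (W (suc r) t) ≡ [] → Runs (stateAt (suc r) t k) xs p ws) →
    ∀ {k} ws′ → k ≤ N → drop k (W (suc r) t) ≡ ws′ → Runs (stateAt (suc r) t k) xs p (ws′ ++ ws)
  run-writes r≤ t≤ next [] k≤ eq = next k≤ eq
  run-writes {r} {t} r≤ t≤ next {k} (w ∷ ws′) k≤ eq =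
    run-write input {stateAt (suc r) t k} {w} {stateAt (suc r) t (suc k)}
      (stateAt-fits r≤ t≤ k≤) (step-stateAt r t k eq)
      (run-writes r≤ t≤ next ws′ (≤-trans (proj₁ tail) (length-W (suc r) t)) (proj₂ tail))
    where tail = drop-∷ k (W (suc r) t) eq

  next-value : ∀ {t} → t < N → ∃[ x ] (drop t xs ≡ x ∷ drop (suc t) xs × toℕ x ≡ A t)
  next-value {t} t<N = drop-valueAt xs (subst (t <_) (sym (length-toList input)) t<N)

  run-next : ∀ {r t k p ws} → suc r ≤ N → t < N → k ≤ N → drop k (W (suc r) t) ≡ [] →
             Runs (stateAt (suc r) (suc t) 0) (drop (suc t) xs) p ws →
             Runs (stateAt (suc r) t k) (drop t xs) p ws
  run-next {r} {t} {k} {p} {ws} r≤ t<N k≤ eq run =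
    subst (λ ys → Runs (stateAt (suc r) t k) ys p ws) (sym drop≡)
      (run-read input {stateAt (suc r) t k} {λ x → suc r , suc t , 0 , summaries , E (toℕ x)} {x}
        (stateAt-fits r≤ (<⇒≤ t<N) k≤) (trans (step-stateAt r t k eq) (advance-read t<N))
        (subst (λ D → Runs (suc r , suc t , 0 , summaries , D) (drop (suc t) xs) p ws)
          (trans (entriesAt-suc t) (cong E (sym x≡))) run))
    where
      E : ℕ → List Entry
      E a = addEntries t (t , a) summaries (entriesAt t)
      x = proj₁ (next-value t<N)
      drop≡ = proj₁ (proj₂ (next-value t<N))
      x≡ = proj₂ (proj₂ (next-value t<N))

  run-passes : ∀ d {r} → suc r + d ≡ l → ∀ e {t} → t + e ≡ N →
               Runs (stateAt (suc r) t 0) (drop t xs) d (passWrites (suc r) t e ++ passesFrom (suc (suc r)) d)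
  run-passes d {r} eqˡ (suc e) {t} eqᴺ = subst (Runs (stateAt (suc r) t 0) (drop t xs) d)
    (sym (++-assoc (W (suc r) t) (passWrites (suc r) (suc t) e) _))
    (run-writes r≤N (<⇒≤ t<N)
      (λ k≤ eq → run-next r≤N t<N k≤ eq (run-passes d eqˡ e (trans (sym (+-suc t e)) eqᴺ)))
      (W (suc r) t) z≤n refl)
    where
      t<N : t < N
      t<N = subst (t <_) eqᴺ (m<m+n t (s≤s z≤n))
      r≤N : suc r ≤ N
      r≤N = ≤-trans (≤-trans (m≤m+n (suc r) d) (≤-reflexive eqˡ)) l≤N
  run-passes zero {r} eqˡ zero {t} eqᴺ =
    run-writes r≤N (≤-reflexive t≡N)
      (λ {k} k≤ eq → run-halt input {stateAt (suc r) t k} (stateAt-fits r≤N (≤-reflexive t≡N) k≤)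
        (trans (step-stateAt r t k eq)
          (advance-halt (≤-reflexive (sym t≡N)) (≤-reflexive (trans (sym eqˡ) (+-identityʳ _))))))
      (W (suc r) t) z≤n refl
    where
      t≡N : t ≡ N
      t≡N = trans (sym (+-identityʳ t)) eqᴺ
      r≤N : suc r ≤ N
      r≤N = ≤-trans (≤-trans (m≤m+n (suc r) zero) (≤-reflexive eqˡ)) l≤N
  run-passes (suc d) {r} eqˡ zero {t} eqᴺ =
    run-writes r≤N (≤-reflexive t≡N)
      (λ {k} k≤ eq → run-rewind input {stateAt (suc r) t k} {suc (suc r) , 0 , 0 , summaries , noEntries}
        (stateAt-fits r≤N (≤-reflexive t≡N) k≤)
        (trans (step-stateAt r t k eq)
          (advance-rewind (≤-reflexive (sym t≡N)) (subst (suc r <_) eqˡ (m<m+n (suc r) (s≤s z≤n)))))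
        (subst (λ D → Runs (suc (suc r) , 0 , 0 , summaries , D) xs d (passesFrom (suc (suc r)) (suc d)))
          entriesAt-zero
          (run-passes d (trans (sym (+-suc (suc r) d)) eqˡ) N refl)))
      (W (suc r) t) z≤n refl
    where
      t≡N : t ≡ N
      t≡N = trans (sym (+-identityʳ t)) eqᴺ
      r≤N : suc r ≤ N
      r≤N = ≤-trans (≤-trans (m≤m+n (suc r) (suc d)) (≤-reflexive eqˡ)) l≤N

  scanning : ℕ → State
  scanning t = 0 , t , 0 , summariesAt t , noEntries

  scanning-fits : ∀ {t} → t ≤ N → Fits (scanning t)
  scanning-fits {t} t≤N = subst (λ D → Fits (0 , t , 0 , summariesAt t , D)) entriesAt-zero
    (fits {0} {t} {0} {t} {0} z≤n t≤N z≤n t≤N z≤n)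

  step-read : ∀ {t E D} → t < N →
    step (0 , t , 0 , E , D) ≡ read (λ x → 0 , suc t , 0 , addSummaries (t , toℕ x) E , D)
  step-read {t} t<N with t <? N
  ... | yes _ = refl
  ... | no t≮N = contradiction t<N t≮N

  step-rewind : ∀ {t E D} → N ≤ t → step (0 , t , 0 , E , D) ≡ rewind (1 , 0 , 0 , E , D)
  step-rewind {t} N≤t with t <? N
  ... | yes t<N = contradiction N≤t (<⇒≱ t<N)
  ... | no _ = refl

  run-scan : ∀ {d} → suc d ≡ l → ∀ e {t} → t + e ≡ N → Runs (scanning t) (drop t xs) l (passesFrom 1 l)
  run-scan {d} 1+d≡l zero {t} eqᴺ =
    subst (λ l′ → Runs (scanning t) (drop t xs) l′ (passesFrom 1 l′)) 1+d≡l
      (run-rewind input {scanning t} {1 , 0 , 0 , summariesAt t , noEntries}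
        (scanning-fits (≤-reflexive t≡N)) (step-rewind (≤-reflexive (sym t≡N)))
        (subst (λ E → Runs (1 , 0 , 0 , summariesAt E , noEntries) xs d (passesFrom 1 (suc d))) (sym t≡N)
          (subst (λ D → Runs (1 , 0 , 0 , summaries , D) xs d (passesFrom 1 (suc d))) entriesAt-zero
            (run-passes d 1+d≡l N refl))))
    where
      t≡N : t ≡ N
      t≡N = trans (sym (+-identityʳ t)) eqᴺ
  run-scan eqˡ (suc e) {t} eqᴺ = subst (λ ys → Runs (scanning t) ys l (passesFrom 1 l)) (sym drop≡)
    (run-read input {scanning t} {λ x → 0 , suc t , 0 , E (toℕ x) , noEntries} {x}
      (scanning-fits (<⇒≤ t<N)) (step-read t<N)
      (subst (λ E → Runs (0 , suc t , 0 , E , noEntries) (drop (suc t) xs) l (passesFrom 1 l))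
        (trans (summariesAt-suc t) (cong E (sym x≡)))
        (run-scan eqˡ e (trans (sym (+-suc t e)) eqᴺ))))
    where
      t<N : t < N
      t<N = subst (t <_) eqᴺ (m<m+n t (s≤s z≤n))
      E : ℕ → List (List Item)
      E a = addSummaries (t , a) (summariesAt t)
      x = proj₁ (next-value t<N)
      drop≡ = proj₁ (proj₂ (next-value t<N))
      x≡ = proj₂ (proj₂ (next-value t<N))

  start≡ : scanning 0 ≡ start
  start≡ = cong (λ E → 0 , 0 , 0 , E , noEntries) (applyUpTo-cong (suc n) λ _ → take-[] l)

  produces : Produces algorithm input (suc l) (passesFrom 1 l)
  produces = l , refl , subst (λ st → Runs st xs l (passesFrom 1 l)) start≡
    (run-scan (m+[n∸m]≡n 1≤l) N refl)

-- Output

filter-merge : ∀ {X : Set} {P Q S : X → Set} (P? : Decidable P) (Q? : Decidable Q) (S? : Decidable S) →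
  (∀ {x} → S x → P x ⊎ Q x) → (∀ {x} → P x → S x) → (∀ {x} → Q x → S x) → (∀ {x} → P x → ¬ Q x) →
  ∀ xs → filter P? xs ++ filter Q? xs ↭ filter S? xs
filter-merge P? Q? S? split inP inQ disj [] = ↭-refl
filter-merge P? Q? S? split inP inQ disj (x ∷ xs) with filter-merge P? Q? S? split inP inQ disj xs
... | ih with P? x | Q? x | S? x
... | yes p | yes q | _ = contradiction q (disj p)
... | yes _ | no _ | yes _ = ↭-prep x ih
... | no _ | yes _ | yes _ = ↭-trans (shift x (filter P? xs) (filter Q? xs)) (↭-prep x ih)
... | no ¬p | no ¬q | yes s = contradiction (split s) [ ¬p , ¬q ]′
... | yes p | _ | no ¬s = contradiction (inP p) ¬s
... | no _ | yes q | no ¬s = contradiction (inQ q) ¬s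
... | no _ | no _ | no _ = ih

-- Counting recurses at the largest position, lists at position 0; these lemmas split off position 0
-- so that windows can be handled by induction on the input.
module _ {P : ℕ → Set} (P? : Decidable P) where

  #-first : ∀ n → P 0 → # P? (suc n) ≡ suc (# (P? ∘ suc) n)
  #-first zero p = #-yes P? p
  #-first (suc n) p with P? (suc n)
  ... | yes _ = cong suc (#-first n p)
  ... | no _ = #-first n p

  #-first-no : ∀ n → ¬ P 0 → # P? (suc n) ≡ # (P? ∘ suc) n
  #-first-no zero ¬p = #-no P? ¬p
  #-first-no (suc n) ¬p with P? (suc n)
  ... | yes _ = cong suc (#-first-no n ¬p)
  ... | no _ = #-first-no n ¬p

-- From counts to order statistics of the input list

atMostᵛ? : ∀ {R} v → Decidable (λ (x : Value R) → toℕ x ≤ v)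
atMostᵛ? v x = toℕ x ≤? v

inWindow? : ∀ {R} K i v (xs : List (Value R)) → Decidable (λ p → Win K i p × valueAt xs p ≤ v)
inWindow? K i v xs p = win? K i p ×-dec (valueAt xs p ≤? v)

#-shift : ∀ {R} K v x (xs : List (Value R)) →
          # (inWindow? (suc K) 0 v (x ∷ xs) ∘ suc) (length xs) ≡ # (inWindow? K 0 v xs) (length xs)
#-shift K v x xs = #-cong (inWindow? (suc K) 0 v (x ∷ xs) ∘ suc) (inWindow? K 0 v xs) (length xs)
  (λ { _ ((_ , s≤s p<) , a≤v) → (z≤n , p<) , a≤v })
  (λ { _ ((_ , p<) , a≤v) → (z≤n , s≤s p<) , a≤v })

#-window : ∀ {R} K i v (xs : List (Value R)) →
           # (inWindow? K i v xs) (length xs) ≡ ct (atMostᵛ? v) (take K (drop i xs))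
#-window zero zero v [] = refl
#-window (suc K) zero v [] = refl
#-window zero (suc i) v [] = refl
#-window (suc K) (suc i) v [] = refl
#-window K (suc i) v (x ∷ xs) = trans
  (#-first-no (inWindow? K (suc i) v (x ∷ xs)) (length xs) λ { ((() , _) , _) })
  (trans (#-cong (inWindow? K (suc i) v (x ∷ xs) ∘ suc) (inWindow? K i v xs) (length xs)
      (λ { _ ((s≤s i≤p , s≤s p<) , a≤v) → (i≤p , p<) , a≤v })
      (λ { _ ((i≤p , p<) , a≤v) → (s≤s i≤p , s≤s p<) , a≤v }))
    (#-window K i v xs))
#-window zero zero v (x ∷ xs) = #-none (inWindow? 0 0 v (x ∷ xs)) (length (x ∷ xs)) λ { _ ((_ , ()) , _) }
#-window (suc K) zero v (x ∷ xs) with toℕ x ≤? v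
... | yes x≤v = trans
  (#-first (inWindow? (suc K) 0 v (x ∷ xs)) (length xs) ((z≤n , s≤s z≤n) , x≤v))
  (trans (cong suc (trans (#-shift K v x xs) (#-window K zero v xs)))
    (cong length (sym (filter-accept (atMostᵛ? v) x≤v))))
... | no x≰v = trans
  (#-first-no (inWindow? (suc K) 0 v (x ∷ xs)) (length xs) λ (_ , x≤v) → x≰v x≤v)
  (trans (trans (#-shift K v x xs) (#-window K zero v xs))
    (cong length (sym (filter-reject (atMostᵛ? v) x≰v))))

-- The head is at most v, so dropping it lowers by one the counts at all values from the head
-- upwards, and with them the rank. Values below the head have count 0 and satisfy the bound
-- trivially.
sorted-nth : ∀ {R} l {zs : List (Value R)} {v} → AllPairs Fin._≤_ zs → suc l ≤ ct (atMostᵛ? (toℕ v)) zs →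
             (∀ {w} → w < toℕ v → ct (atMostᵛ? w) zs < suc l) → head (drop l zs) ≡ just v
sorted-nth {R} l {z ∷ zs} {v} (z≤ ∷ sorted) enough least = at l z≤v enough least
  where
    z≤v : toℕ z ≤ toℕ v
    z≤v = ≮⇒≥ λ v<z → contradiction (subst (suc l ≤_)
      (ct-none (atMostᵛ? (toℕ v)) (<⇒≱ v<z ∷ All.map (λ z≤x → <⇒≱ (<-≤-trans v<z z≤x)) z≤)) enough) λ ()

    accept : ∀ {w} → toℕ z ≤ w → ct (atMostᵛ? w) (z ∷ zs) ≡ suc (ct (atMostᵛ? w) zs)
    accept {w} z≤w = cong length (filter-accept (atMostᵛ? w) z≤w)

    at : ∀ l → toℕ z ≤ toℕ v → suc l ≤ ct (atMostᵛ? (toℕ v)) (z ∷ zs) →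
         (∀ {w} → w < toℕ v → ct (atMostᵛ? w) (z ∷ zs) < suc l) → head (drop l (z ∷ zs)) ≡ just v
    at zero z≤v _ least = [ (λ z<v → contradiction
        (subst (_< 1) (accept ≤-refl) (least z<v)) λ { (s≤s ()) })
      , cong just ∘ toℕ-injective ]′ (m≤n⇒m<n∨m≡n z≤v)
    at (suc l) z≤v enough least = sorted-nth l sorted
      (s≤s⁻¹ (subst (suc (suc l) ≤_) (accept z≤v) enough))
      λ {w} w<v → [ (λ w<z → subst (_< suc l)
          (sym (ct-none (atMostᵛ? w) (All.map (λ z≤x → <⇒≱ (<-≤-trans w<z z≤x)) z≤))) (s≤s z≤n))
        , (λ z≤w → s≤s⁻¹ (subst (_< suc (suc l)) (accept z≤w) (least w<v))) ]′ (<-≤-connex w (toℕ z))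

isSmallest : ∀ {R} l (ys : List (Value R)) v → suc l ≤ ct (atMostᵛ? (toℕ v)) ys →
             (∀ {w} → w < toℕ v → ct (atMostᵛ? w) ys < suc l) → IsSmallest (suc l) ys v
isSmallest {R} l ys v enough least = sorted-nth l (Linked⇒AllPairs ≤-trans (sort-↗ ys))
  (subst (suc l ≤_) (sym (ct-↭ (atMostᵛ? (toℕ v)) (sort-↭ ys))) enough)
  (λ {w} w<v → subst (_< suc l) (sym (ct-↭ (atMostᵛ? w) (sort-↭ ys))) (least w<v))
  where open Sort (≤-decTotalOrder (suc R)) using (sort-↗; sort-↭)

-- The written positions and their values

module Output (N K R l b : ℕ) (1≤l : 1 ≤ l) (l≤K : l ≤ K) (K≤N : K ≤ N)
              (N<nB : N < l * suc b * suc b) (input : Vec (Value R) N) where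

  open Execution N K R l b 1≤l l≤K K≤N input
  open Machine N K R l b
  open Semantics N K R l b 1≤l l≤K K≤N A (valueAt≤R xs)
  open Windows N K R l 1≤l l≤K A (valueAt≤R xs)

  Pos : Set
  Pos = Position N K

  positions : List Pos
  positions = allFin (suc (N ∸ K))

  τ ρ : Pos → ℕ
  τ i = timeOf (group i)
  ρ i = passOf (group i)

  i≤N∸K : ∀ (i : Pos) → toℕ i ≤ N ∸ K
  i≤N∸K i = s≤s⁻¹ (toℕ<n i)

  group<n : ∀ i → group i < n
  group<n i = m<n*o⇒m/o<n (≤-<-trans (≤-trans (i≤N∸K i) (m∸n≤m N K)) N<nB)

  group-mono : ∀ {i i′ : Pos} → i Fin.≤ i′ → group i ≤ group i′
  group-mono i≤i′ = /-monoˡ-≤ B i≤i′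

  grid≤ : ∀ i → grid (group i) ≤ toℕ i
  grid≤ i = ≤-trans (m⊓n≤m _ _) (m/n*n≤m (toℕ i) B)

  ≤grid : ∀ i → toℕ i ≤ grid (suc (group i))
  ≤grid i = ⊓-glb (≤-trans (≤-reflexive (m≡m%n+[m/n]*n (toℕ i) B)) (+-monoˡ-≤ _ (<⇒≤ (m%n<n (toℕ i) B)))) (i≤N∸K i)

  time≡τ : ∀ i → time (nth [] summaries (group i)) (nth [] summaries (suc (group i))) ≡ τ i
  time≡τ i = cong₂ time (nth-summaries (m≤n⇒m≤1+n (group<n i))) (nth-summaries (s≤s (group<n i)))

  pass≡ρ : ∀ i → pass (nth [] summaries (group i)) (nth [] summaries (suc (group i))) ≡ ρ i
  pass≡ρ i = cong₂ pass (nth-summaries (m≤n⇒m≤1+n (group<n i))) (nth-summaries (s≤s (group<n i)))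

  From : ℕ → ℕ → Pos → Set
  From r t i = t ≤ τ i × ρ i ≡ r

  from? : ∀ r t → Decidable (From r t)
  from? r t i = (t ≤? τ i) ×-dec (ρ i ≟ r)

  due⇒ : ∀ {r t i} → Due r t summaries i → τ i ≡ t × ρ i ≡ r
  due⇒ {i = i} (time≡ , pass≡) = trans (sym (time≡τ i)) time≡ , trans (sym (pass≡ρ i)) pass≡

  due⇐ : ∀ {r t i} → τ i ≡ t → ρ i ≡ r → Due r t summaries i
  due⇐ {i = i} τ≡ ρ≡ = trans (time≡τ i) τ≡ , trans (pass≡ρ i) ρ≡

  duePositions : ℕ → ℕ → List Pos
  duePositions r t = filter (due? r t summaries) positions

  positions-W : ∀ r t → map proj₁ (W r t) ≡ duePositions r t
  positions-W r t = trans (sym (map-∘ (duePositions r t))) (map-id (duePositions r t))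

  passPositions : ℕ → ℕ → ℕ → List Pos
  passPositions r t e = map proj₁ (passWrites r t e)

  passPositions-suc : ∀ r t e → passPositions r t (suc e) ≡ duePositions r t ++ passPositions r (suc t) e
  passPositions-suc r t e = trans (map-++ proj₁ (W r t) (passWrites r (suc t) e))
    (cong (_++ passPositions r (suc t) e) (positions-W r t))

  passPositions-↭ : ∀ r e {t} → t + e ≡ N → passPositions r t e ↭ filter (from? r t) positions
  passPositions-↭ r zero {t} eqᴺ = ↭-reflexive (trans (positions-W r t)
    (filter-≐ (due? r t summaries) (from? r t)
      ( (λ {i} due → ≤-reflexive (sym (proj₁ (due⇒ {i = i} due))) , proj₂ (due⇒ {i = i} due))
      , (λ {i} (t≤τ , ρ≡r) → due⇐ {i = i} (≤-antisym (≤-trans (timeOf≤N (group i))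
          (≤-reflexive (trans (sym eqᴺ) (+-identityʳ t)))) t≤τ) ρ≡r))
      positions))
  passPositions-↭ r (suc e) {t} eqᴺ = ↭-trans (↭-reflexive (passPositions-suc r t e))
    (↭-trans (++⁺ ↭-refl (passPositions-↭ r e (trans (sym (+-suc t e)) eqᴺ)))
      (filter-merge (due? r t summaries) (from? r (suc t)) (from? r t)
        (λ {i} (t≤τ , ρ≡r) → [ (λ t<τ → inj₂ (t<τ , ρ≡r)) , (λ t≡τ → inj₁ (due⇐ {i = i} (sym t≡τ) ρ≡r)) ]′
          (m≤n⇒m<n∨m≡n t≤τ))
        (λ {i} due → ≤-reflexive (sym (proj₁ (due⇒ {i = i} due))) , proj₂ (due⇒ {i = i} due))
        (λ (t<τ , ρ≡r) → <⇒≤ t<τ , ρ≡r)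
        (λ {i} due (t<τ , _) → <-irrefl (sym (proj₁ (due⇒ {i = i} due))) t<τ)
        positions))

  allPositions-↭ : ∀ d r → r + d ≡ suc l → map proj₁ (passesFrom r d) ↭ filter (λ i → r ≤? ρ i) positions
  allPositions-↭ zero r eq = ↭-reflexive (sym (filter-none (λ i → r ≤? ρ i)
    (All.universal (λ i r≤ρ → <⇒≱ (≤-reflexive (trans (sym eq) (+-identityʳ r))) (≤-trans r≤ρ (passOf≤l (group i)))) positions)))
  allPositions-↭ (suc d) r eq = ↭-trans
    (↭-reflexive (map-++ proj₁ (passWrites r 0 N) (passesFrom (suc r) d)))
    (↭-trans (++⁺ (passPositions-↭ r N refl) (allPositions-↭ d (suc r) (trans (sym (+-suc r d)) eq)))
      (filter-merge (from? r 0) (λ i → suc r ≤? ρ i) (λ i → r ≤? ρ i)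
        (λ r≤ρ → [ inj₂ , (λ r≡ρ → inj₁ (z≤n , sym r≡ρ)) ]′ (m≤n⇒m<n∨m≡n r≤ρ))
        (λ (_ , ρ≡r) → ≤-reflexive (sym ρ≡r))
        <⇒≤
        (λ (_ , ρ≡r) r<ρ → <-irrefl (sym ρ≡r) r<ρ)
        positions))

  writtenOnce : WrittenOnce {N} {K} (map proj₁ (passesFrom 1 l))
  writtenOnce = ↭-trans (allPositions-↭ l 1 refl)
    (↭-reflexive (filter-all (λ i → 1 ≤? ρ i) (All.universal (λ i → 1≤passOf (group i)) positions)))

  Increasing : List Pos → Set
  Increasing = AllPairs Fin._<_

  due-increasing : ∀ r t → Increasing (duePositions r t)
  due-increasing r t = AllPairsₚ.filter⁺ (due? r t summaries) (AllPairsₚ.tabulate⁺-< id)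

  -- Positions due at one time are filtered from an increasing list. Between different times the
  -- order comes from the contrapositive of `timeOf-mono` at equal r.
  pass-increasing : ∀ r e {t} → t + e ≡ N → Increasing (passPositions r t e)
  pass-increasing r zero {t} eqᴺ = subst Increasing (sym (positions-W r t)) (due-increasing r t)
  pass-increasing r (suc e) {t} eqᴺ = subst Increasing (sym (passPositions-suc r t e))
    (AllPairsₚ.++⁺ (due-increasing r t) (pass-increasing r e eqᴺ′)
      (All.map (λ due → All.map (before due) later) (Allₚ.all-filter (due? r t summaries) positions)))
    where
      eqᴺ′ : suc t + e ≡ N
      eqᴺ′ = trans (sym (+-suc t e)) eqᴺ
      later : All (From r (suc t)) (passPositions r (suc t) e)
      later = All-resp-↭ (↭-sym (passPositions-↭ r e eqᴺ′)) (Allₚ.all-filter (from? r (suc t)) positions)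
      before : ∀ {i i′} → Due r t summaries i → From r (suc t) i′ → i Fin.< i′
      before {i} {i′} due (t<τ′ , ρ′≡r) = ≰⇒> λ i′≤i → <⇒≱ t<τ′ (≤-trans
        (timeOf-mono (group-mono {i′} {i} i′≤i) (trans ρ′≡r (sym (proj₂ (due⇒ {i = i} due)))))
        (≤-reflexive (proj₁ (due⇒ {i = i} due))))

  scans : ℕ → ℕ → List (List Pos)
  scans r zero = []
  scans r (suc d) = passPositions r 0 N ∷ scans (suc r) d

  length-scans : ∀ r d → length (scans r d) ≡ d
  length-scans r zero = refl
  length-scans r (suc d) = cong suc (length-scans (suc r) d)

  concat-scans : ∀ r d → concat (scans r d) ≡ map proj₁ (passesFrom r d)
  concat-scans r zero = refl
  concat-scans r (suc d) = trans (cong (passPositions r 0 N ++_) (concat-scans (suc r) d))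
    (sym (map-++ proj₁ (passWrites r 0 N) (passesFrom (suc r) d)))

  scans-linked : ∀ r d → All (Linked Fin._<_) (scans r d)
  scans-linked r zero = []
  scans-linked r (suc d) = AllPairs⇒Linked (pass-increasing r N refl) ∷ scans-linked (suc r) d

  outputPasses : OutputPasses {N} {K} l (map proj₁ (passesFrom 1 l))
  outputPasses = scans 1 l , length-scans 1 l , scans-linked 1 l , concat-scans 1 l

  Correct : Pos × Value R → Set
  Correct (i , v) = IsSmallest l (window K input i) v

  toℕ-clamp : ∀ {m} → m ≤ R → toℕ (clamp R m) ≡ m
  toℕ-clamp m≤R = trans (toℕ-fromℕ< _) (m≤n⇒m⊓n≡m m≤R)

  whole≡ct : ∀ i v → whole i v ≡ ct (atMostᵛ? v) (take K (drop i xs))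
  whole≡ct i v = trans (cong (# (inWindow? K i v xs)) (sym (length-toList input))) (#-window K i v xs)

  answer-correct : ∀ (i : Pos) m → m ≤ R → l ≤ whole (toℕ i) m → (∀ {w} → w < m → whole (toℕ i) w < l) →
                   Correct (i , clamp R m)
  answer-correct i m m≤R enough least = at l 1≤l enough least
    where
      at : ∀ l → 1 ≤ l → l ≤ whole (toℕ i) m → (∀ {w} → w < m → whole (toℕ i) w < l) →
           IsSmallest l (window K input i) (clamp R m)
      at (suc l) _ enough least = isSmallest l (window K input i) (clamp R m)
        (subst (suc l ≤_) (trans (whole≡ct (toℕ i) m) (cong (λ m → ct (atMostᵛ? m) (window K input i)) (sym (toℕ-clamp m≤R)))) enough)
        (λ {w} w< → subst (_< suc l) (whole≡ct (toℕ i) w) (least (subst (w <_) (toℕ-clamp m≤R) w<)))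

  write-correct : ∀ i → Correct (writeAt (ρ i) (τ i) summaries (entriesAt (τ i)) i)
  write-correct i = subst (λ m → Correct (i , clamp R m)) (sym answer≡)
    (answer-correct i (answerOf (group i) (grid≤ i) (≤grid i))
      (answerOf-≤ (group i) (grid≤ i) (≤grid i))
      (answerOf-enough (group i) (grid≤ i) (≤grid i))
      (answerOf-least (group i) (grid≤ i) (≤grid i)))
    where
      answer≡ : answer (ρ i) (τ i) (nth [] summaries (group i)) (nth [] summaries (suc (group i)))
                  (nth noEntry (entriesAt (τ i)) (group i)) (toℕ i)
              ≡ answerOf (group i) (grid≤ i) (≤grid i)
      answer≡ = trans
        (cong₂ (λ e e′ → answer (ρ i) (τ i) e e′ (nth noEntry (entriesAt (τ i)) (group i)) (toℕ i))
          (nth-summaries (m≤n⇒m≤1+n (group<n i))) (nth-summaries (s≤s (group<n i))))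
        (cong (λ d → answer (ρ i) (τ i) (summ (group i)) (summ (suc (group i))) d (toℕ i))
          (nth-entries (τ i) (group<n i)))

  W-correct : ∀ r t → All Correct (W r t)
  W-correct r t = Allₚ.map⁺ (All.map (λ {i} due → at {i} (proj₁ (due⇒ {i = i} due)) (proj₂ (due⇒ {i = i} due)))
    (Allₚ.all-filter (due? r t summaries) positions))
    where
      at : ∀ {i} → τ i ≡ t → ρ i ≡ r → Correct (writeAt r t summaries (entriesAt t) i)
      at {i} τ≡t ρ≡r = subst (λ r → Correct (writeAt r t summaries (entriesAt t) i)) ρ≡r
        (subst (λ t → Correct (writeAt (ρ i) t summaries (entriesAt t) i)) τ≡t (write-correct i))

  passWrites-correct : ∀ r t e → All Correct (passWrites r t e)
  passWrites-correct r t zero = W-correct r t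
  passWrites-correct r t (suc e) = Allₚ.++⁺ (W-correct r t) (passWrites-correct r (suc t) e)

  passes-correct : ∀ r d → All Correct (passesFrom r d)
  passes-correct r zero = []
  passes-correct r (suc d) = Allₚ.++⁺ (passWrites-correct r 0 N) (passes-correct (suc r) d)

-- Block length and final bound

-- Here b is the integer part of √(N/l): the upper inequality makes the groups cover all windows,
-- the lower one bounds the space.
blockSize : ∀ l N → 1 ≤ l → ∃[ b ] (l * (b * b) ≤ N × N < l * suc b * suc b)
blockSize l zero 1≤l = 0 , ≤-reflexive (*-zeroʳ l) , *-mono-≤ (*-mono-≤ 1≤l (s≤s z≤n)) (s≤s z≤n)
blockSize l (suc N) 1≤l with blockSize l N 1≤l
... | b , lb²≤N , N< with suc N <? l * suc b * suc b
...   | yes 1+N< = b , m≤n⇒m≤1+n lb²≤N , 1+N<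
...   | no 1+N≮ = suc b , ≤-trans (≤-reflexive (sym (*-assoc l (suc b) (suc b)))) (≮⇒≥ 1+N≮) ,
  ≤-<-trans N< (*-mono-<′ (*-monoʳ-≤ l (n≤1+n (suc b))))
  where
    *-mono-<′ : l * suc b ≤ l * suc (suc b) → l * suc b * suc b < l * suc (suc b) * suc (suc b)
    *-mono-<′ le = ≤-<-trans (*-monoˡ-≤ (suc b) le)
      (*-monoʳ-< (l * suc (suc b)) {{>-nonZero (*-mono-≤ 1≤l (s≤s z≤n))}} (n<1+n (suc b)))

-- Rounding up at most doubles a positive b, whence the factor 4; for b = 0 the bound rests on l ≤
-- N.
lB²≤4N : ∀ {l N b} → l ≤ N → l * (b * b) ≤ N → l * (suc b * suc b) ≤ 4 * N
lB²≤4N {l} {N} {zero} l≤N _ = ≤-trans (≤-reflexive (*-identityʳ l)) (≤-trans l≤N (m≤m+n N _))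
lB²≤4N {l} {N} {suc b} _ lb²≤N = begin
  l * (suc (suc b) * suc (suc b))   ≤⟨ *-monoʳ-≤ l (*-mono-≤ double double) ⟩
  l * ((2 * suc b) * (2 * suc b))   ≡⟨ solve 2 (λ l b → l :* ((con 2 :* b) :* (con 2 :* b)) := con 4 :* (l :* (b :* b))) refl l (suc b) ⟩
  4 * (l * (suc b * suc b))         ≤⟨ *-monoʳ-≤ 4 lb²≤N ⟩
  4 * N                             ∎
  where
    open ≤-Reasoning
    open +-*-Solver
    double : suc (suc b) ≤ 2 * suc b
    double = s≤s (≤-trans (m≤m+n (suc b) (b + 0)) (≤-reflexive (sym (+-suc b (b + 0)))))

-- The square of 42wl²B is (42w)²l³ · lB². The factor 4 in lB² ≤ 4N turns 42 into 84.
spaceBound : ∀ {N K R l b} → l ≤ N → l * (b * b) ≤ N → SpaceBound 84 l N R (Memory.space N K R l b)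
spaceBound {N} {K} {R} {l} {b} l≤N lb²≤N = begin
  (42 * (w * (l * (l * suc b)))) ^ 2
    ≡⟨ solve 3 (λ w l B → (con 42 :* (w :* (l :* (l :* B)))) :^ 2 :=
                          (con 42 :* w) :^ 2 :* (l :^ 3 :* (l :* (B :* B)))) refl w l (suc b) ⟩
  (42 * w) ^ 2 * (l ^ 3 * (l * (suc b * suc b)))
    ≤⟨ *-monoʳ-≤ ((42 * w) ^ 2) (*-monoʳ-≤ (l ^ 3) (lB²≤4N {l} {N} {b} l≤N lb²≤N)) ⟩
  (42 * w) ^ 2 * (l ^ 3 * (4 * N))
    ≡⟨ solve 3 (λ w l N → (con 42 :* w) :^ 2 :* (l :^ 3 :* (con 4 :* N)) :=
                          (con 84 :* w) :^ 2 :* (l :^ 3 :* N)) refl w l N ⟩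
  (84 * w) ^ 2 * (l ^ 3 * N) ∎
  where
    open ≤-Reasoning
    open +-*-Solver
    w = logTerm N R

theorem4p12 : ∃[ C ] ((l : ℕ) → 1 ≤ l →
    (N K R : ℕ) → l ≤ K → K ≤ N →
    ∃[ s ] (SpaceBound C l N R s ×
    ∃[ A ] SolvesSliding {N} {K} {R} {s} l (suc l) l A))
theorem4p12 = 84 , λ l 1≤l N K R l≤K K≤N →
  let b , lb²≤N , N<nB = blockSize l N 1≤l
      open Machine N K R l b using (start; step)
      open Memory N K R l b using (space; stateCode)
  in space , spaceBound {N} {K} {R} {l} {b} (≤-trans l≤K K≤N) lb²≤N ,
     Compile.algorithm stateCode space start step , λ input →
       let open Execution N K R l b 1≤l l≤K K≤N input using (passesFrom; produces)
           open Output N K R l b 1≤l l≤K K≤N N<nB input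
       in suc l , passesFrom 1 l , ≤-refl , produces , writtenOnce , outputPasses , passes-correct 1 l
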